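{- Let $\mathsf{C2.FM}$ be $\mathsf{C2.F}$ plus the McKinsey axiom schema $\Box\Diamond p\to\Diamond\Box p$. Then $\mathsf{C2.FM}$ is sound and weakly complete with respect to final ordinal sequence frames: for every $p\in\mathcal{L}_>$, $\vdash_{\mathsf{C2.FM}}p$ if and only if $p$ is true at every element of every order model based on a final ordinal sequence frame.
   Context: Language. Let $At=\{p_0,p_1,\ldots\}$ be a countably infinite set of atoms. $\mathcal{L}_>$ is generated by $p ::= p_k\in At\mid \neg p\mid (p\wedge p)\mid (p>p)$; $\vee,\to,\leftrightarrow$ are defined as usual; $\Box p$ abbreviates $\neg p>p$, and $\Diamond p$ abbreviates $\neg\Box\neg p$. Logics. $\mathsf{C2}$ is the smallest set of $\mathcal{L}_>$-sentences containing all instances of: (PC) every (substitution instance of a) theorem of classical propositional logic; (Identity) $p>p$; (Reciprocity) $(p>q)\wedge(q>p)\wedge(p>r)\to(q>r)$; (MP) $(p>q)\to(p\to q)$; (CEM) $(p>q)\vee(p>\neg q)$; and closed under (Detachment) from $\vdash p\to q$ and $\vdash p$ infer $\vdash q$; (Normality) from $\vdash(p\wedge q)\to r$ infer $\vdash((s>p)\wedge(s>q))\to(s>r)$. $\mathsf{C2.F}$ is the smallest extension of $\mathsf{C2}$ containing every instance of (Flattening) $(p>((p\wedge q)>r))\leftrightarrow((p\wedge q)>r)$ and closed under Detachment and Normality. Adding a schema to a logic means taking the smallest extension containing every instance of the schema and closed under Detachment and Normality. Order frames and models. An order frame is a pair $\langle W,<\rangle$ where $W\neq\varnothing$ and $<$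 is a function taking each $w\in W$ to a strict well-order $<_w$ on some subset of $W$ such that whenever $x<_w y$, either $w=x$ or $w<_w x$. Put $R(w)=\{w\}\cup\{v: w<_w v\}$. An order model $\langle W,<,V\rangle$ adds a valuation $V:At\times W\to\{0,1\}$; put $V(p_k)=\{w:V(p_k,w)=1\}$. Denotations: $[\![p_k]\!]=V(p_k)$, $[\![\neg p]\!]=W\setminus[\![p]\!]$, $[\![p\wedge q]\!]=[\![p]\!]\cap[\![q]\!]$, and $w\in[\![p>q]\!]$ iff either $R(w)\cap[\![p]\!]=\varnothing$, or there is $y\in R(w)\cap[\![p]\!]\cap[\![q]\!]$ such that $x\notin[\![p]\!]$ whenever $x<_w y$. A sentence $p$ is true at $w$ iff $w\in[\![p]\!]$. Ordinal sequences. For an ordinal $\alpha$ and non-empty set $P$, an $\alpha$-sequence over $P$ is a function $\sigma:\alpha\to P$. For $\beta\le\alpha$ the $\beta$th tail $\sigma^{[\beta:]}$ is the sequence of length $\alpha-\beta$ with $\sigma^{[\beta:]}(\gamma)=\sigma(\beta+\gamma)$; the rank in $\sigma$ of a tail $\tau$ of $\sigma$ is the least $\beta$ with $\tau=\sigma^{[\beta:]}$. The tail order function $\prec^W$ on a set $W$ of ordinal sequences has $\tau\prec^W_\sigma\rho$ iff $\tau,\rho,\sigma\in W$, $\tau$ and $\rho$ are tails of $\sigma$, and the rank of $\tau$ in $\sigma$ is less than the rank of $\rho$ in $\sigma$. An ordinal sequence frame is an order frame $\langle W,\prec^W\rangle$ where $W$ is a set of ordinal sequences (finite or transfinite; $W$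 is not required to be closed under tails or to exclude the empty sequence). A final ordinal sequence frame is an ordinal sequence frame $\langle W,\prec^W\rangle$ such that whenever $\sigma\in W$, there exists $\beta$ such that $\sigma^{[\beta:]}\in W$ and, whenever $\gamma\ge\beta$ and $\sigma^{[\gamma:]}$ is defined and in $W$, $\sigma^{[\gamma:]}=\sigma^{[\beta:]}$. -}

module Defs where

open import Data.Bool.Base using (Bool; true; not) renaming (_∧_ to _∧ᵇ_)
open import Data.Nat.Base using (ℕ)
open import Data.Product.Base using (Σ-syntax; ∃-syntax; _×_)
open import Data.Refinement.Base using (Refinement-syntax; value)
open import Data.Refinement.Properties using (value-injective)
open import Data.Sum.Base using (_⊎_)
open import Function.Base using (_on_)
open import Induction.WellFounded using (WellFounded)
open import Level using (Level; Lift; suc)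
open import Relation.Binary.Core using (Rel)
open import Relation.Binary.Definitions using (Transitive; Trichotomous; Tri; tri<; tri≈; tri>)
open import Relation.Binary.Morphism.Structures using (IsOrderIsomorphism)
open import Relation.Binary.PropositionalEquality using (_≡_; cong; isEquivalence)
open import Relation.Binary.Structures using (IsStrictTotalOrder)
open import Relation.Binary.Structures.Biased using (isStrictTotalOrderᶜ)
open import Relation.Nullary.Construct.Add.Supremum using (_⁺; [_])
open import Relation.Nullary.Negation.Core using (¬_)
open import Relation.Unary using (Pred; _∈_; _∉_; _∪_; _∩_; ∁; Empty; ｛_｝)
import Relation.Binary.Construct.Add.Supremum.Strict as Supremum
import Relation.Binary.Construct.On as On

private
  variable
    ℓ : Level

------------------------------------------------------------------------
-- Language

infix  9 ¬̇_ □_ ◇_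
infixr 7 _∧̇_
infixr 6 _∨̇_
infix  5 _>̇_
infixr 4 _→̇_
infix  3 _↔̇_

data Formula : Set where
  atom : ℕ → Formula
  ¬̇_   : Formula → Formula
  _∧̇_  : Formula → Formula → Formula
  _>̇_  : Formula → Formula → Formula

_∨̇_ _→̇_ _↔̇_ : Formula → Formula → Formula
p ∨̇ q = ¬̇ (¬̇ p ∧̇ ¬̇ q)
p →̇ q = ¬̇ (p ∧̇ ¬̇ q)
p ↔̇ q = (p →̇ q) ∧̇ (q →̇ p)

□_ ◇_ : Formula → Formula
□ p = (¬̇ p) >̇ p
◇ p = ¬̇ (□ (¬̇ p))

------------------------------------------------------------------------
-- Classical propositional logic, whose theorems are taken to be the
-- two-valued tautologies

data Propositional : Set where
  var  : ℕ → Propositional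
  neg  : Propositional → Propositional
  conj : Propositional → Propositional → Propositional

eval : (ℕ → Bool) → Propositional → Bool
eval v (var k)    = v k
eval v (neg φ)    = not (eval v φ)
eval v (conj φ ψ) = eval v φ ∧ᵇ eval v ψ

Tautology : Propositional → Set
Tautology φ = ∀ v → eval v φ ≡ true

substitute : (ℕ → Formula) → Propositional → Formula
substitute s (var k)    = s k
substitute s (neg φ)    = ¬̇ substitute s φ
substitute s (conj φ ψ) = substitute s φ ∧̇ substitute s ψ

------------------------------------------------------------------------
-- Logics

-- Ax ⊢ p : p belongs to the smallest extension of C2 that contains Ax and
-- is closed under Detachment and Normality.
infix 2 _⊢_

data _⊢_ (Ax : Pred Formula Level.zero) : Pred Formula Level.zero where
  axiom       : ∀ {p} → p ∈ Ax → Ax ⊢ p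
  PC          : ∀ φ → Tautology φ → (s : ℕ → Formula) → Ax ⊢ substitute s φ
  identity    : ∀ p → Ax ⊢ p >̇ p
  reciprocity : ∀ p q r → Ax ⊢ ((p >̇ q) ∧̇ (q >̇ p) ∧̇ (p >̇ r)) →̇ (q >̇ r)
  MP          : ∀ p q → Ax ⊢ (p >̇ q) →̇ (p →̇ q)
  CEM         : ∀ p q → Ax ⊢ (p >̇ q) ∨̇ (p >̇ ¬̇ q)
  detachment  : ∀ {p q} → Ax ⊢ p →̇ q → Ax ⊢ p → Ax ⊢ q
  normality   : ∀ {p q r} s → Ax ⊢ (p ∧̇ q) →̇ r →
                Ax ⊢ ((s >̇ p) ∧̇ (s >̇ q)) →̇ (s >̇ r)

data Flattening : Pred Formula Level.zero where
  flattening : ∀ p q r →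
    Flattening ((p >̇ ((p ∧̇ q) >̇ r)) ↔̇ ((p ∧̇ q) >̇ r))

data McKinsey : Pred Formula Level.zero where
  mcKinsey : ∀ p → McKinsey (□ ◇ p →̇ ◇ □ p)

C2FM : Pred Formula Level.zero
C2FM = Flattening ∪ McKinsey

------------------------------------------------------------------------
-- Order frames and models

-- _<_ is a strict well-order on the subset S of A.  Elements outside S are
-- incomparable to everything, so WellFounded constrains _<_ on S only.
record IsStrictWellOrderOn {A : Set ℓ} (S : Pred A ℓ) (_<_ : Rel A ℓ) : Set ℓ where
  field
    within      : ∀ {x y} → x < y → x ∈ S × y ∈ S
    trans       : Transitive _<_
    compare     : ∀ {x y} → x ∈ S → y ∈ S → Tri (x < y) (x ≡ y) (y < x)
    wellFounded : WellFounded _<_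

record IsOrderFrame (W : Set ℓ) (_∶_<_ : W → Rel W ℓ) : Set (suc ℓ) where
  field
    nonempty    : W
    domain      : W → Pred W ℓ
    isWellOrder : ∀ w → IsStrictWellOrderOn (domain w) (w ∶_<_)
    below       : ∀ {w x y} → w ∶ x < y → w ≡ x ⊎ w ∶ w < x

record OrderFrame ℓ : Set (suc ℓ) where
  infix 4 _∶_<_
  field
    W            : Set ℓ
    _∶_<_        : W → Rel W ℓ
    isOrderFrame : IsOrderFrame W _∶_<_

  R : W → Pred W ℓ
  R w = ｛ w ｝ ∪ (w ∶ w <_)

record OrderModel ℓ : Set (suc ℓ) where
  constructor ⟨_,_⟩
  field
    frame : OrderFrame ℓ
  open OrderFrame frame public
  field
    V : ℕ → W → Bool

  ⟦_⟧ : Formula → Pred W ℓ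
  ⟦ atom k ⟧ w = Lift ℓ (V k w ≡ true)
  ⟦ ¬̇ p    ⟧   = ∁ ⟦ p ⟧
  ⟦ p ∧̇ q  ⟧   = ⟦ p ⟧ ∩ ⟦ q ⟧
  ⟦ p >̇ q  ⟧ w =
      Empty (R w ∩ ⟦ p ⟧)
    ⊎ (∃[ y ] y ∈ R w ∩ ⟦ p ⟧ ∩ ⟦ q ⟧ × (∀ x → w ∶ x < y → x ∉ ⟦ p ⟧))

TrueAt : (M : OrderModel ℓ) → OrderModel.W M → Formula → Set ℓ
TrueAt M w p = w ∈ OrderModel.⟦_⟧ M p

------------------------------------------------------------------------
-- Ordinals and ordinal sequences

-- An ordinal is represented by a well-ordered type of that order type; its
-- elements are the smaller ordinals.
record Ordinal ℓ : Set (suc ℓ) where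
  infix 4 _<_
  field
    Carrier            : Set ℓ
    _<_                : Rel Carrier ℓ
    isStrictTotalOrder : IsStrictTotalOrder _≡_ _<_
    wellFounded        : WellFounded _<_

  open Supremum _<_ public using (_<⁺_)

record Sequence (P : Set ℓ) : Set (suc ℓ) where
  field
    length : Ordinal ℓ
  open Ordinal length public using (_<⁺_) renaming (Carrier to Index; _<_ to _<ᵢ_)
  field
    at : Index → P

  -- The ordinals β ≤ length, the added supremum being length itself.
  Position : Set ℓ
  Position = Index ⁺

infix 4 _≈_

-- Equality of sequences.  Equal ordinals are isomorphic well-orders, and an
-- isomorphism between well-orders is unique, so i and to i are the same
-- ordinal.
record _≈_ {P : Set ℓ} (σ τ : Sequence P) : Set ℓ where
  private
    module σ = Sequence σ
    module τ = Sequence τ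
  field
    to                 : σ.Index → τ.Index
    isOrderIsomorphism : IsOrderIsomorphism _≡_ _≡_ σ._<ᵢ_ τ._<ᵢ_ to
    at-≡               : ∀ i → σ.at i ≡ τ.at (to i)

-- The ordinal α - β is the order type of { i < α : β ≤ i }, whose γth element
-- is β + γ.
remainder : (α : Ordinal ℓ) → Ordinal.Carrier α ⁺ → Ordinal ℓ
remainder α β = record
  { Carrier            = Rest
  ; _<_                = α._<_ on value
  ; isStrictTotalOrder = isStrictTotalOrderᶜ record
    { isEquivalence = isEquivalence
    ; trans         = α.trans
    ; compare       = compare
    }
  ; wellFounded        = On.wellFounded value α.wellFounded
  }
  where
  module α where
    open Ordinal α public
    open IsStrictTotalOrder isStrictTotalOrder public using (trans; compare)

  Rest = [ i ∈ α.Carrier ∣ ¬ ([ i ] α.<⁺ β) ]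

  compare : Trichotomous {A = Rest} _≡_ (α._<_ on value)
  compare x y with α.compare (value x) (value y)
  ... | tri< a ¬b ¬c = tri< a (λ e → ¬b (cong value e)) ¬c
  ... | tri≈ ¬a b ¬c = tri≈ ¬a (value-injective b) ¬c
  ... | tri> ¬a ¬b c = tri> ¬a (λ e → ¬b (cong value e)) c

infix 10 _[_:]

_[_:] : {P : Set ℓ} (σ : Sequence P) → Sequence.Position σ → Sequence P
σ [ β :] = record
  { length = remainder (Sequence.length σ) β
  ; at     = λ i → Sequence.at σ (value i)
  }

IsRank : {P : Set ℓ} (σ τ : Sequence P) → Sequence.Position σ → Set ℓ
IsRank σ τ β = τ ≈ σ [ β :] × (∀ γ → γ <⁺ β → ¬ (τ ≈ σ [ γ :]))
  where open Sequence σ using (_<⁺_)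

------------------------------------------------------------------------
-- Ordinal sequence frames

module _ {P W : Set ℓ} (seq : W → Sequence P) where

  tailOrder : W → Rel W ℓ
  tailOrder σ τ ρ =
    ∃[ β ] ∃[ γ ] IsRank (seq σ) (seq τ) β × IsRank (seq σ) (seq ρ) γ × β <⁺ γ
    where open Sequence (seq σ) using (_<⁺_)

-- A set of sequences is presented as an indexed family without repetitions,
-- so that propositional equality of indices is equality of sequences.
record OrdinalSequenceFrame ℓ : Set (suc ℓ) where
  field
    P            : Set ℓ
    P-nonempty   : P
    W            : Set ℓ
    seq          : W → Sequence P
    seq-distinct : ∀ {w w′} → seq w ≈ seq w′ → w ≡ w′
    isOrderFrame : IsOrderFrame W (tailOrder seq)

  orderFrame : OrderFrame ℓ
  orderFrame = record { isOrderFrame = isOrderFrame }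

  InW : Pred (Sequence P) ℓ
  InW σ = ∃[ w ] seq w ≈ σ

IsFinal : OrdinalSequenceFrame ℓ → Set ℓ
IsFinal F = ∀ w → let open Sequence (seq w) using (Position; _<⁺_) in
  Σ[ β ∈ Position ] InW (seq w [ β :]) ×
    (∀ γ → ¬ (γ <⁺ β) → InW (seq w [ γ :]) → seq w [ γ :] ≈ seq w [ β :])
  where open OrdinalSequenceFrame F

{-# OPTIONS --safe #-}

-- Soundness.  If x is the world nearest to w satisfying P, and Q ⊆ P, then the
-- world nearest to w satisfying Q is also the one nearest to x: a tail of a
-- tail of σ is a tail of σ, and whatever precedes x in the order of w fails P.
-- In a final frame every w sees a world that sees only itself.
--
-- Completeness.  A maximal consistent set Γ selects, for each s possible at Γ,
-- the maximal consistent set { r : s > r ∈ Γ }.  Fix the subformulas of an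
-- unprovable p.  Call a world settled if it decides every subformula once and
-- for all; by McKinsey's axiom every world sees a settled one.  Sort the other
-- worlds into cells by the subformulas they contain.  By induction on n, from
-- any world in one of n cells there runs a path inside these cells, of order
-- type at most ω^n, along which the world selected by a subformula q is always
-- the next q-world: follow a path inside all cells but one, which can be left
-- only into the omitted cell or to the outside, and repeat, omitting each cell
-- in turn.  If this goes on for ever then every cell recurs, and otherwise the
-- path leaves the n cells; in both cases nothing has been skipped.  The path
-- through all unsettled cells, followed by the settled world to which it is
-- left, is a well-order with a last element, whose tails form a final frame.

module Submission where

open import Defs
open import Axiom.ExcludedMiddle using (ExcludedMiddle)
open import Data.Bool.Base using (Bool; true; false; not; T) renaming (_∧_ to _∧ᵇ_)
open import Data.Bool.Properties using (T-∧; T-≡; ¬-not)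
open import Data.Empty using (⊥; ⊥-elim-irr)
open import Data.Fin.Base using (Fin; zero; suc; toℕ; punchIn; punchOut)
open import Data.Fin.Properties using (toℕ-injective; toℕ-fromℕ<; toℕ<n; punchIn-punchOut)
open import Data.Irrelevant using ([_])
open import Data.List.Base as List using (List; []; _∷_; _++_; map; cartesianProductWith; lookup)
open import Data.List.Membership.Propositional using () renaming (_∈_ to _∈ˡ_)
open import Data.List.Membership.Propositional.Properties
  using (∈-map⁺; ∈-map⁻; ∈-++⁺ˡ; ∈-++⁺ʳ; ∈-++⁻; ∈-cartesianProductWith⁺; ∈-lookup)
open import Data.List.Relation.Unary.Any using (here; there; index)
open import Data.List.Relation.Unary.Any.Properties using (lookup-index)
open import Data.Maybe.Base using (Maybe; just; nothing; is-just; _>>=_)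
open import Data.Maybe.Properties using (just-injective)
open import Data.Nat.Base as ℕ using (ℕ; zero; suc; _+_; _*_; _⊔_; s≤s; _≤′_; ≤′-refl; ≤′-step)
open import Data.Nat.DivMod using (_mod_; m%n<n; [m+kn]%n≡m%n; m<n⇒m%n≡m)
import Data.Nat.Induction as ℕ
open import Data.Nat.Properties as ℕ using (≤⇒≤′; m≤m⊔n; m≤n⊔m)
open import Data.Product.Base using (Σ-syntax; ∃; ∃-syntax; _×_; _,_; proj₁; proj₂)
open import Data.Refinement.Base using (Refinement-syntax; value; _,_)
open import Data.Refinement.Properties using (value-injective)
open import Data.Sum.Base using (_⊎_; inj₁; inj₂; [_,_]′)
open import Data.Vec.Base using (Vec; []; _∷_; replicate)
open import Data.Vec.Relation.Binary.Lex.Strict as Lex using (Lex-<; base; this; next)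
open import Data.Vec.Relation.Binary.Pointwise.Inductive using (Pointwise-≡⇒≡; ≡⇒Pointwise-≡)
open import Function.Base using (_∘_; id; _on_)
open import Function.Bundles using (_⇔_; mk⇔; Equivalence)
open import Function.Construct.Composition using (_⇔-∘_)
open import Function.Construct.Identity using (⇔-id)
open import Function.Construct.Symmetry using (⇔-sym)
open import Induction.WellFounded using (WellFounded; Acc; acc; wf⇒asym; module Subrelation)
open import Level using (Level; Lift; lift; lower; 0ℓ)
import Relation.Binary.Construct.Add.Supremum.Strict as Supremum
open import Relation.Binary.Construct.Add.Supremum.Strict using ([_]; [_]<⊤⁺; <⁺-trans; <⁺-cmp-≡)
import Relation.Binary.Construct.On as On
open import Relation.Binary.Core using (Rel)
open import Relation.Binary.Definitions using (Transitive; Asymmetric; Trichotomous; Tri; tri<; tri≈; tri>)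
open import Relation.Binary.Morphism.Structures using (IsOrderIsomorphism)
open import Relation.Binary.PropositionalEquality
  using (_≡_; refl; sym; trans; cong; cong₂; subst; resp₂; isEquivalence)
open import Relation.Binary.Structures using (IsEquivalence; IsStrictTotalOrder)
open import Relation.Binary.Structures.Biased using (isStrictTotalOrderᶜ)
open import Relation.Nullary.Construct.Add.Supremum using (_⁺; [_]; ⊤⁺; []-injective)
open import Relation.Nullary.Decidable using (dec-true; dec-false)
open import Relation.Nullary.Decidable.Core using (yes; no; does; proof; decidable-stable)
open import Relation.Nullary.Negation.Core using (¬_; contradiction)
open import Relation.Nullary.Reflects using (Reflects; invert; ¬-reflects; _×-reflects_)
open import Relation.Unary using (Pred; _∈_; _∩_)

private
  variable
    a ℓ r : Level

-- Validity in order frames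

module Classical (em : ∀ {a} → ExcludedMiddle a) where

  by-contradiction : {A : Set a} → ¬ ¬ A → A
  by-contradiction = decidable-stable em

  least : {A : Set a} {_<_ : Rel A r} → WellFounded _<_ → (P : Pred A ℓ) → ∀ {x} → P x →
          ∃[ y ] P y × (∀ z → z < y → ¬ P z)
  least {_<_ = _<_} wf P {x} px = descend px (wf x)
    where
    descend : ∀ {x} → P x → Acc _<_ x → ∃[ y ] P y × (∀ z → z < y → ¬ P z)
    descend {x} px (acc rs) with em {P = ∃[ z ] z < x × P z}
    ... | yes (z , z<x , pz) = descend pz (rs z<x)
    ... | no none            = x , px , λ z z<x pz → none (z , z<x , pz)

  module Soundness (M : OrderModel ℓ) where

    open OrderModel M
    open IsOrderFrame isOrderFrame
    module _ {w : W} where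
      open IsStrictWellOrderOn (isWellOrder w) public
        renaming (trans to <-trans)

    <-asym : ∀ {w x y} → w ∶ x < y → ¬ w ∶ y < x
    <-asym = wf⇒asym wellFounded

    <-irrefl : ∀ {w x} → ¬ w ∶ x < x
    <-irrefl x<x = <-asym x<x x<x


    R-compare : ∀ {w x y} → x ∈ R w → y ∈ R w → w ∶ x < y ⊎ x ≡ y ⊎ w ∶ y < x
    R-compare (inj₁ refl) (inj₁ refl) = inj₂ (inj₁ refl)
    R-compare (inj₁ refl) (inj₂ w<y)  = inj₁ w<y
    R-compare (inj₂ w<x)  (inj₁ refl) = inj₂ (inj₂ w<x)
    R-compare (inj₂ w<x)  (inj₂ w<y) with compare (proj₂ (within w<x)) (proj₂ (within w<y))
    ... | tri< x<y _ _ = inj₁ x<y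
    ... | tri≈ _ x≡y _ = inj₂ (inj₁ x≡y)
    ... | tri> _ _ y<x = inj₂ (inj₂ y<x)

    Nearest : W → Pred W ℓ → Pred W ℓ
    Nearest w P y = y ∈ R w × P y × (∀ x → w ∶ x < y → ¬ P x)

    -- By `below`, whatever precedes another world at w lies in `R w`, so a minimum of `R w ∩ P` has
    -- no world satisfying P before it at all.
    nearest : ∀ {w x} (P : Pred W ℓ) → x ∈ R w → P x → ∃ (Nearest w P)
    nearest {w} P x∈R px with least wellFounded (R w ∩ P) (x∈R , px)
    ... | y , (y∈R , py) , first = y , y∈R , py , λ x x<y px → first x x<y (below x<y , px)

    nearest-unique : ∀ {w P y z} → Nearest w P y → Nearest w P z → y ≡ z
    nearest-unique (y∈R , py , y-first) (z∈R , pz , z-first) with R-compare y∈R z∈R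
    ... | inj₁ y<z        = contradiction py (z-first _ y<z)
    ... | inj₂ (inj₁ y≡z) = y≡z
    ... | inj₂ (inj₂ z<y) = contradiction pz (y-first _ z<y)

    nearest-self : ∀ {w} {P : Pred W ℓ} → P w → Nearest w P w
    nearest-self pw = inj₁ refl , pw , λ x x<w _ →
      [ (λ where refl → <-irrefl x<w) , <-asym x<w ]′ (below x<w)

    -- With `>-elim`, this recasts the two-case truth clause as a claim about the one nearest
    -- p-world, vacuous if there is none.
    >-intro : ∀ {p q w} → (∀ {y} → Nearest w ⟦ p ⟧ y → ⟦ q ⟧ y) → ⟦ p >̇ q ⟧ w
    >-intro {p} {q} {w} all with em {P = ∃ (R w ∩ ⟦ p ⟧)}
    ... | no none = inj₁ λ x x∈ → none (x , x∈)
    ... | yes (x , x∈R , px) with nearest ⟦ p ⟧ x∈R px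
    ...   | y , y∈R , py , first = inj₂ (y , (y∈R , py , all (y∈R , py , first)) , first)

    >-elim : ∀ {p q w y} → ⟦ p >̇ q ⟧ w → Nearest w ⟦ p ⟧ y → ⟦ q ⟧ y
    >-elim (inj₁ none) (y∈R , py , _) = contradiction (y∈R , py) (none _)
    >-elim {q = q} (inj₂ (z , (z∈R , pz , qz) , first)) near =
      subst ⟦ q ⟧ (nearest-unique (z∈R , pz , first) near) qz

    →-intro : ∀ {p q w} → (⟦ p ⟧ w → ⟦ q ⟧ w) → ⟦ p →̇ q ⟧ w
    →-intro f (p , ¬q) = ¬q (f p)

    →-elim : ∀ {p q w} → ⟦ p →̇ q ⟧ w → ⟦ p ⟧ w → ⟦ q ⟧ w
    →-elim f p = by-contradiction λ ¬q → f (p , ¬q)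

    □-intro : ∀ {p w} → (∀ {y} → y ∈ R w → ⟦ p ⟧ y) → ⟦ □ p ⟧ w
    □-intro {p} all = >-intro {¬̇ p} {p} λ (y∈R , _) → all y∈R

    □-elim : ∀ {p w y} → ⟦ □ p ⟧ w → y ∈ R w → ⟦ p ⟧ y
    □-elim {p} box y∈R = by-contradiction λ ¬p →
      let _ , near = nearest ⟦ ¬̇ p ⟧ y∈R ¬p in proj₁ (proj₂ near) (>-elim {p = ¬̇ p} {p} box near)

    -- Each variable is valued by whether its substituend holds at w, so a tautology evaluated there
    -- turns into truth at w.
    substitute-reflects : ∀ s w φ →
      Reflects (⟦ substitute s φ ⟧ w) (eval (λ k → does (em {P = ⟦ s k ⟧ w})) φ)
    substitute-reflects s w (var k)    = proof em
    substitute-reflects s w (neg φ)    = ¬-reflects (substitute-reflects s w φ)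
    substitute-reflects s w (conj φ ψ) = substitute-reflects s w φ ×-reflects substitute-reflects s w ψ

    -- The nearest q-world y satisfies p. If a p-world preceded y, so would the nearest p-world,
    -- which satisfies q, against the choice of y. Hence y is also the nearest p-world.
    reciprocal : ∀ {p q r w} → ⟦ p >̇ q ⟧ w → ⟦ q >̇ p ⟧ w → ⟦ p >̇ r ⟧ w → ⟦ q >̇ r ⟧ w
    reciprocal {p} {q} {r} {w} p>q q>p p>r = >-intro {q} {r} λ {y} near →
      let y∈R , qy , first = near in
      >-elim {p} {r} p>r
        ( y∈R
        , >-elim {q} {p} q>p near
        , λ x x<y px → let z , z-near = nearest ⟦ p ⟧ (below x<y) px in
            earlier-absurd first x<y px z-near (R-compare (proj₁ z-near) y∈R))
      where
      earlier-absurd : ∀ {x y z} → (∀ x → w ∶ x < y → ¬ ⟦ q ⟧ x) → w ∶ x < y → ⟦ p ⟧ x →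
                       Nearest w ⟦ p ⟧ z → w ∶ z < y ⊎ z ≡ y ⊎ w ∶ y < z → ⊥
      earlier-absurd first x<y px z-near (inj₁ z<y) = first _ z<y (>-elim {p} {q} p>q z-near)
      earlier-absurd first x<y px (_ , _ , z-first) (inj₂ (inj₁ refl)) = z-first _ x<y px
      earlier-absurd first x<y px (_ , _ , z-first) (inj₂ (inj₂ y<z)) = z-first _ (<-trans x<y y<z) px

    sound : ∀ {Ax} → (∀ {p} → p ∈ Ax → ∀ w → ⟦ p ⟧ w) → ∀ {p} → Ax ⊢ p → ∀ w → ⟦ p ⟧ w
    sound ax (axiom a) w = ax a w
    sound ax (PC φ taut s) w =
      invert (subst (Reflects _) (taut _) (substitute-reflects s w φ))
    sound ax (identity p) w = >-intro {p} {p} λ (_ , py , _) → py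
    sound ax (reciprocity p q r) w = →-intro {(p >̇ q) ∧̇ (q >̇ p) ∧̇ (p >̇ r)} {q >̇ r}
      λ (p>q , q>p , p>r) → reciprocal {p} {q} {r} p>q q>p p>r
    sound ax (MP p q) w = →-intro {p >̇ q} {p →̇ q} λ p>q → →-intro {p} {q} λ pw →
      >-elim {p} {q} p>q (nearest-self pw)
    sound ax (CEM p q) w (¬p>q , ¬p>¬q) = ¬p>¬q (>-intro {p} {¬̇ q} λ near qy →
      ¬p>q (>-intro {p} {q} λ near′ → subst ⟦ q ⟧ (nearest-unique near near′) qy))
    sound ax (detachment {p} {q} d e) w = →-elim {p} {q} (sound ax d w) (sound ax e w)
    sound ax (normality {p} {q} {r} s d) w = →-intro {(s >̇ p) ∧̇ (s >̇ q)} {s >̇ r} λ (s>p , s>q) →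
      >-intro {s} {r} λ {y} near → →-elim {p ∧̇ q} {r} (sound ax d y)
        (>-elim {s} {p} s>p near , >-elim {s} {q} s>q near)

    -- At a world that sees only itself, p, `□ p` and `◇ p` agree.
    mcKinsey-valid : (∀ w → ∃[ u ] u ∈ R w × (∀ {y} → y ∈ R u → y ≡ u)) →
                     ∀ p w → ⟦ □ ◇ p →̇ ◇ □ p ⟧ w
    mcKinsey-valid final p w = →-intro {□ ◇ p} {◇ □ p} λ □◇p □¬□p →
      let u , u∈R , only = final w in
      □-elim {◇ p} □◇p u∈R (□-intro {¬̇ p} λ y∈Ru py →
        □-elim {¬̇ □ p} □¬□p u∈R (□-intro {p} λ z∈Ru →
          subst ⟦ p ⟧ (trans (only y∈Ru) (sym (only z∈Ru))) py))

    module _ (R-trans : ∀ {w x y} → x ∈ R w → y ∈ R x → y ∈ R w)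
             (forward : ∀ {w x y} → w ∶ x < y → x ∶ x < y)
             (forward₂ : ∀ {w x y z} → w ∶ x < y → w ∶ y < z → x ∶ y < z) where

      -- As y satisfies P, it cannot precede x. A Q-world z before y at x cannot come after y at w,
      -- since `forward` or `forward₂` would copy that order to x; so z precedes y at w, against the
      -- choice of y.
      nearest-nearest : ∀ {P Q : Pred W ℓ} {w x y} → (∀ {z} → Q z → P z) →
                        Nearest w P x → Nearest w Q y → Nearest x Q y
      nearest-nearest {Q = Q} {w} {x} {y} Q⊆P (x∈R , px , x-first) (y∈R , qy , y-first) =
        y∈Rx , qy , λ z z<y qz → absurd z<y qz (R-compare (R-trans x∈R (below z<y)) y∈R)
        where
        y∈Rx : y ∈ R x
        y∈Rx with R-compare x∈R y∈R
        ... | inj₁ x<y        = inj₂ (forward x<y)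
        ... | inj₂ (inj₁ x≡y) = inj₁ x≡y
        ... | inj₂ (inj₂ y<x) = contradiction (Q⊆P qy) (x-first _ y<x)

        absurd : ∀ {z} → x ∶ z < y → Q z → w ∶ z < y ⊎ z ≡ y ⊎ w ∶ y < z → ⊥
        absurd z<y qz (inj₁ z<ʷy)        = y-first _ z<ʷy qz
        absurd z<y qz (inj₂ (inj₁ refl)) = <-irrefl z<y
        absurd z<y qz (inj₂ (inj₂ y<ʷz)) with R-compare x∈R y∈R
        ... | inj₁ x<y         = <-asym z<y (forward₂ x<y y<ʷz)
        ... | inj₂ (inj₁ refl) = <-asym z<y (forward y<ʷz)
        ... | inj₂ (inj₂ y<x)  = x-first _ y<x (Q⊆P qy)

      flattening-valid : ∀ p q r w → ⟦ (p >̇ ((p ∧̇ q) >̇ r)) ↔̇ ((p ∧̇ q) >̇ r) ⟧ w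
      flattening-valid p q r w =
          →-intro {p >̇ (pq >̇ r)} {pq >̇ r} (λ flat → >-intro {pq} {r} λ near@(y∈R , (py , _) , _) →
            let x , x-near = nearest ⟦ p ⟧ y∈R py in
            >-elim {pq} {r} (>-elim {p} {pq >̇ r} flat x-near) (nearest-nearest proj₁ x-near near))
        , →-intro {pq >̇ r} {p >̇ (pq >̇ r)} (λ flat → >-intro {p} {pq >̇ r} λ {x} x-near →
            >-intro {pq} {r} λ {y} y-near@(y∈Rx , qy , _) →
              let z , z-near = nearest ⟦ pq ⟧ (R-trans (proj₁ x-near) y∈Rx) qy in
              subst ⟦ r ⟧ (nearest-unique (nearest-nearest proj₁ x-near z-near) y-near)
                (>-elim {pq} {r} flat z-near))
        where pq = p ∧̇ q

-- Tails of ordinal sequences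

<⁺-wellFounded : {A : Set a} {_<_ : Rel A r} → WellFounded _<_ →
                 WellFounded (Supremum._<⁺_ _<_)
<⁺-wellFounded {_<_ = _<_} wf = λ where
    [ k ] → acc-[] (wf k)
    ⊤⁺    → acc λ where [ k ]<⊤⁺ → acc-[] (wf k)
  where
  open Supremum _<_ using (_<⁺_)
  acc-[] : ∀ {k} → Acc _<_ k → Acc _<⁺_ [ k ]
  acc-[] (acc rs) = acc λ where [ j<k ] → acc-[] (rs j<k)

module SequenceProperties {P : Set ℓ} where

  module Order (σ : Sequence P) where
    open Sequence σ public
    private module L = Ordinal length
    open L public using (wellFounded)
    open IsStrictTotalOrder L.isStrictTotalOrder public using (compare) renaming (trans to <ᵢ-trans)

    <ᵢ-asym : Asymmetric _<ᵢ_
    <ᵢ-asym = wf⇒asym wellFounded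

    pos-wf : WellFounded _<⁺_
    pos-wf = <⁺-wellFounded wellFounded

    pos-asym : Asymmetric _<⁺_
    pos-asym = wf⇒asym pos-wf

    pos-irrefl : ∀ {β} → ¬ (β <⁺ β)
    pos-irrefl β<β = pos-asym β<β β<β

    pos-trans : Transitive _<⁺_
    pos-trans = <⁺-trans _ <ᵢ-trans

    pos-compare : Trichotomous _≡_ _<⁺_
    pos-compare = <⁺-cmp-≡ _ compare

    ≮-<-trans : ∀ {β γ δ} → ¬ (γ <⁺ β) → γ <⁺ δ → ¬ (δ <⁺ β)
    ≮-<-trans γ≮β γ<δ δ<β = γ≮β (pos-trans γ<δ δ<β)

    ≮-trans : ∀ {β γ δ} → ¬ (γ <⁺ β) → ¬ (δ <⁺ γ) → ¬ (δ <⁺ β)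
    ≮-trans {β} {γ} γ≮β δ≮γ δ<β with pos-compare β γ
    ... | tri< β<γ _ _  = δ≮γ (pos-trans δ<β β<γ)
    ... | tri≈ _ refl _ = δ≮γ δ<β
    ... | tri> _ _ γ<β  = γ≮β γ<β

    in-tail : ∀ {β} i → ¬ ([ i ] <⁺ β) → Sequence.Index (σ [ β :])
    in-tail i i≮β = i , [ i≮β ]

    tail-≮ : ∀ {β} (i : Sequence.Index (σ [ β :])) → ¬ ([ value i ] <⁺ β)
    tail-≮ (i , [ i≮β ]) i<β = ⊥-elim-irr (i≮β i<β)

  module _ {σ τ : Sequence P} where
    private
      module σ = Order σ
      module τ = Order τ

    -- Trichotomy in σ and asymmetry in τ supply injectivity and reflection of the order.
    ≈-intro : (to : σ.Index → τ.Index) → (∀ {i j} → i σ.<ᵢ j → to i τ.<ᵢ to j) →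
              (∀ j → ∃[ i ] to i ≡ j) → (∀ i → σ.at i ≡ τ.at (to i)) → σ ≈ τ
    ≈-intro to mono surj at-≡ = record
      { to = to
      ; isOrderIsomorphism = record
        { isOrderMonomorphism = record
          { isOrderHomomorphism = record { cong = cong to ; mono = mono }
          ; injective = injective
          ; cancel = cancel
          }
        ; surjective = λ j → let i , eq = surj j in i , λ where refl → eq
        }
      ; at-≡ = at-≡
      }
      where
      irrefl : ∀ {i j} → to i ≡ to j → ¬ (to i τ.<ᵢ to j)
      irrefl {i} eq lt = τ.<ᵢ-asym lt′ lt′ where lt′ = subst (to i τ.<ᵢ_) (sym eq) lt

      injective : ∀ {i j} → to i ≡ to j → i ≡ j
      injective {i} {j} eq with σ.compare i j
      ... | tri< i<j _ _ = contradiction (mono i<j) (irrefl eq)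
      ... | tri≈ _ i≡j _ = i≡j
      ... | tri> _ _ j<i = contradiction (mono j<i) (irrefl (sym eq))

      cancel : ∀ {i j} → to i τ.<ᵢ to j → i σ.<ᵢ j
      cancel {i} {j} lt with σ.compare i j
      ... | tri< i<j _ _  = i<j
      ... | tri≈ _ refl _ = contradiction lt (irrefl refl)
      ... | tri> _ _ j<i  = contradiction lt (τ.<ᵢ-asym (mono j<i))

    module Iso (e : σ ≈ τ) where
      open _≈_ e public using (to; at-≡)
      open IsOrderIsomorphism (_≈_.isOrderIsomorphism e) public using (mono; cancel)

      from : τ.Index → σ.Index
      from j = proj₁ (IsOrderIsomorphism.surjective (_≈_.isOrderIsomorphism e) j)

      to-from : ∀ j → to (from j) ≡ j
      to-from j = proj₂ (IsOrderIsomorphism.surjective (_≈_.isOrderIsomorphism e) j) refl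

  ≈-refl : ∀ {σ : Sequence P} → σ ≈ σ
  ≈-refl = ≈-intro id id (λ j → j , refl) (λ _ → refl)

  ≈-sym : ∀ {σ τ : Sequence P} → σ ≈ τ → τ ≈ σ
  ≈-sym {σ} {τ} e = ≈-intro from
    (λ {i} {j} i<j → cancel (subst (λ k → k τ.<ᵢ to (from j)) (sym (to-from i))
                               (subst (i τ.<ᵢ_) (sym (to-from j)) i<j)))
    (λ i → to i , injective (to-from (to i)))
    (λ j → sym (trans (at-≡ (from j)) (cong τ.at (to-from j))))
    where
    module τ = Sequence τ
    open Iso e
    open IsOrderIsomorphism (_≈_.isOrderIsomorphism e) using (injective)

  ≈-trans : ∀ {ρ σ τ : Sequence P} → ρ ≈ σ → σ ≈ τ → ρ ≈ τ
  ≈-trans d e = ≈-intro (E.to ∘ D.to) (E.mono ∘ D.mono)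
    (λ k → D.from (E.from k) , trans (cong E.to (D.to-from _)) (E.to-from k))
    (λ i → trans (D.at-≡ i) (E.at-≡ (D.to i)))
    where
    module D = Iso d
    module E = Iso e

  -- Addition of β, as a map from the positions of σ [ β :] to those of σ.
  module Shift {σ τ : Sequence P} {β} (e : τ ≈ σ [ β :]) where
    private
      module σ = Order σ
      module τ = Order τ
      open Iso e

    shift : τ.Position → σ.Position
    shift [ i ] = [ value (to i) ]
    shift ⊤⁺    = ⊤⁺

    shift-≮ : ∀ ε → ¬ (shift ε σ.<⁺ β)
    shift-≮ [ i ] = σ.tail-≮ (to i)
    shift-≮ ⊤⁺    ()

    shift-mono : ∀ {ε ζ} → ε τ.<⁺ ζ → shift ε σ.<⁺ shift ζ
    shift-mono [ i<j ]   = [ mono i<j ]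
    shift-mono [ i ]<⊤⁺  = [ _ ]<⊤⁺

    shift-cancel : ∀ {ε ζ} → shift ε σ.<⁺ shift ζ → ε τ.<⁺ ζ
    shift-cancel {[ i ]} {[ j ]} [ i<j ] = [ cancel i<j ]
    shift-cancel {[ i ]} {⊤⁺}    _       = [ i ]<⊤⁺
    shift-cancel {⊤⁺}    {[ _ ]} ()
    shift-cancel {⊤⁺}    {⊤⁺}    ()

    unshift : ∀ γ → ¬ (γ σ.<⁺ β) → ∃[ ε ] shift ε ≡ γ
    unshift [ j ] j≮β = [ from (σ.in-tail j j≮β) ] , cong ([_] ∘ value) (to-from _)
    unshift ⊤⁺    _   = ⊤⁺ , refl

    -- Associativity of ordinal addition, read on tails: `shift ε` is β + ε, and the isomorphism is
    -- that of `e` restricted to the indices from ε on.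
    tail-shift : ∀ ε → τ [ ε :] ≈ σ [ shift ε :]
    tail-shift ε = ≈-intro
      (λ i → σ.in-tail (value (to (value i))) (λ lt → τ.tail-≮ i (shift-cancel {ζ = ε} lt)))
      mono
      (λ j → let j≮β = σ.≮-trans (shift-≮ ε) (σ.tail-≮ j)
                 i   = from (σ.in-tail (value j) j≮β)
                 i≡j = cong value (to-from (σ.in-tail (value j) j≮β)) in
         τ.in-tail i (λ lt → σ.tail-≮ j (subst (λ k → [ k ] σ.<⁺ shift ε) i≡j (shift-mono lt)))
         , value-injective i≡j)
      (λ i → at-≡ (value i))

    -- An earlier occurrence of ρ in τ would shift to an earlier occurrence in σ.
    rank-unshift : ∀ {ρ γ} → ¬ (γ σ.<⁺ β) → IsRank σ ρ γ → ∃[ ε ] shift ε ≡ γ × IsRank τ ρ ε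
    rank-unshift γ≮β (ρ≈ , first) with unshift _ γ≮β
    ... | ε , refl = ε , refl , ≈-trans ρ≈ (≈-sym (tail-shift ε)) ,
      λ ζ ζ<ε ρ≈′ → first (shift ζ) (shift-mono ζ<ε) (≈-trans ρ≈′ (tail-shift ζ))

  rank-unique : ∀ {σ τ : Sequence P} {β γ} → IsRank σ τ β → IsRank σ τ γ → β ≡ γ
  rank-unique {σ} {β = β} {γ} (eβ , first-β) (eγ , first-γ) with Order.pos-compare σ β γ
  ... | tri< β<γ _ _ = contradiction eβ (first-γ _ β<γ)
  ... | tri≈ _ β≡γ _ = β≡γ
  ... | tri> _ _ γ<β = contradiction eγ (first-β _ γ<β)

-- Soundness over final ordinal sequence frames

module ClassicalFrames (em : ∀ {a} → ExcludedMiddle a) (F : OrdinalSequenceFrame ℓ) where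

  open Classical em
  open SequenceProperties
  open OrdinalSequenceFrame F
  open OrderFrame orderFrame using (_∶_<_; R)
  open IsOrderFrame isOrderFrame

  tail-rank : ∀ {w u} β → seq u ≈ seq w [ β :] → ∃ (IsRank (seq w) (seq u))
  tail-rank {w} {u} β e with least (Order.pos-wf (seq w)) (λ γ → seq u ≈ seq w [ γ :]) e
  ... | γ , u≈ , first = γ , u≈ , first

  self-tail : (σ : Sequence P) → ∃[ β ] σ ≈ σ [ β :]
  -- The least of all positions is 0. As σ may be empty, `⊤⁺` serves to show that a position exists.
  self-tail σ with least (Order.pos-wf σ) (λ γ → γ ≡ γ) {⊤⁺} refl
  ... | β , _ , first = β , ≈-intro (λ i → Order.in-tail σ i λ i<β → first _ i<β refl)
                                    id (λ j → value j , refl) (λ _ → refl)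

  -- The rank of u is compared with that of w in itself. If they are equal, the two sequences are
  -- equal, hence so are the worlds by `seq-distinct`.
  tail∈R : ∀ {w u} β → seq u ≈ seq w [ β :] → u ∈ R w
  tail∈R {w} {u} β u≈ with tail-rank β u≈ | tail-rank _ (proj₂ (self-tail (seq w)))
  ... | γ , u-rank | δ , w-rank with Order.pos-compare (seq w) δ γ
  ...   | tri< δ<γ _ _  = inj₂ (δ , γ , w-rank , u-rank , δ<γ)
  ...   | tri≈ _ refl _ = inj₁ (seq-distinct (≈-trans (proj₁ w-rank) (≈-sym (proj₁ u-rank))))
  ...   | tri> _ _ γ<δ  = below (γ , δ , u-rank , w-rank , γ<δ)

  R-trans : ∀ {w x y} → x ∈ R w → y ∈ R x → y ∈ R w
  R-trans (inj₁ refl) y∈R         = y∈R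
  R-trans (inj₂ w<x)  (inj₁ refl) = inj₂ w<x
  R-trans (inj₂ (_ , β , _ , (x≈ , _) , _)) (inj₂ (_ , ε , _ , (y≈ , _) , _)) =
    tail∈R (shift ε) (≈-trans y≈ (tail-shift ε))
    where open Shift x≈

  private
    -- Neither rank in w lies below β, so they have the forms β + ε and β + ζ; cancelling β gives
    -- the ranks in x and keeps their order.
    step : ∀ {w x y z β γ δ} → IsRank (seq w) (seq x) β → IsRank (seq w) (seq y) γ →
           IsRank (seq w) (seq z) δ → let open Sequence (seq w) in
           ¬ (γ <⁺ β) → γ <⁺ δ → x ∶ y < z
    step {w} (x≈ , _) y-rank z-rank γ≮β γ<δ
      with Shift.rank-unshift x≈ γ≮β y-rank
         | Shift.rank-unshift x≈ (Order.≮-<-trans (seq w) γ≮β γ<δ) z-rank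
    ... | ε , refl , y-rank′ | ζ , refl , z-rank′ =
      ε , ζ , y-rank′ , z-rank′ , Shift.shift-cancel x≈ γ<δ

  forward : ∀ {w x y} → w ∶ x < y → x ∶ x < y
  forward {w} (β , γ , x-rank , y-rank , β<γ) =
    step x-rank x-rank y-rank (Order.pos-irrefl (seq w)) β<γ

  forward₂ : ∀ {w x y z} → w ∶ x < y → w ∶ y < z → x ∶ y < z
  forward₂ {w} (β , γ , x-rank , y-rank , β<γ) (γ′ , δ , y-rank′ , z-rank , γ′<δ)
    with refl ← rank-unique y-rank y-rank′ =
    step x-rank y-rank z-rank (Order.pos-asym (seq w) β<γ) γ′<δ

  -- The witness is the final tail: a tail of it is a tail of w no earlier than β, so finality
  -- identifies the two.
  final-world : IsFinal F → ∀ w → ∃[ u ] u ∈ R w × (∀ {y} → y ∈ R u → y ≡ u)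
  final-world final w with final w
  ... | β , (u , u≈) , last = u , tail∈R β u≈ , λ where
    (inj₁ refl) → refl
    (inj₂ (_ , ε , _ , (y≈ , _) , _)) → let open Shift u≈ in
      let y≈′ = ≈-trans y≈ (tail-shift ε) in
      seq-distinct (≈-trans y≈′ (≈-trans (last (shift ε) (shift-≮ ε) (_ , y≈′)) (≈-sym u≈)))

  C2FM-sound : IsFinal F → ∀ V {p} → C2FM ⊢ p → ∀ w → TrueAt ⟨ orderFrame , V ⟩ w p
  C2FM-sound final V = sound λ where
      (inj₁ (flattening p q r)) → flattening-valid R-trans forward forward₂ p q r
      (inj₂ (mcKinsey p))       → mcKinsey-valid (final-world final) p
    where open Soundness ⟨ orderFrame , V ⟩

-- Maximal consistent sets

imp : Propositional → Propositional → Propositional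
imp φ ψ = neg (conj φ (neg ψ))

private
  A B C : Propositional
  A = var 0
  B = var 1
  C = var 2

  assign : {X : Set} → X → X → X → ℕ → X
  assign a b c 0 = a
  assign a b c 1 = b
  assign a b c _ = c

  every : (Bool → Bool) → Bool
  every f = f true ∧ᵇ f false

  every-sound : ∀ f → T (every f) → ∀ b → T (f b)
  every-sound f t true  = proj₁ (Equivalence.to T-∧ t)
  every-sound f t false = proj₂ (Equivalence.to (T-∧ {f true}) t)

  truth-table : Propositional → Bool
  truth-table φ = every λ a → every λ b → every λ c → eval (assign a b c) φ

module Derivations {Ax : Pred Formula 0ℓ} where

  private
    -- The implicit truth table is checked by computation. The argument `agree`, given by `refl`,
    -- says that φ depends on the first three variables alone.
    tautology : ∀ φ {_ : T (truth-table φ)} →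
                (∀ v → eval v φ ≡ eval (assign (v 0) (v 1) (v 2)) φ) →
                ∀ p q r → Ax ⊢ substitute (assign p q r) φ
    tautology φ {t} agree p q r = PC φ
      (λ v → trans (agree v) (Equivalence.to T-≡
        (every-sound (λ c → eval (assign (v 0) (v 1) c) φ)
          (every-sound (λ b → every λ c → eval (assign (v 0) b c) φ)
            (every-sound (λ a → every λ b → every λ c → eval (assign a b c) φ) t (v 0)) (v 1)) (v 2))))
      (assign p q r)

  →-weaken : ∀ p {q} → Ax ⊢ q → Ax ⊢ p →̇ q
  →-weaken p {q} = detachment (tautology (imp B (imp A B)) (λ _ → refl) p q q)

  →-refl : ∀ p → Ax ⊢ p →̇ p
  →-refl p = tautology (imp A A) (λ _ → refl) p p p

  →-trans : ∀ {p q r} → Ax ⊢ p →̇ q → Ax ⊢ q →̇ r → Ax ⊢ p →̇ r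
  →-trans {p} {q} {r} d e = detachment (detachment
    (tautology (imp (imp A B) (imp (imp B C) (imp A C))) (λ _ → refl) p q r) d) e

  →-∧ : ∀ {p q r} → Ax ⊢ p →̇ q → Ax ⊢ p →̇ r → Ax ⊢ p →̇ q ∧̇ r
  →-∧ {p} {q} {r} d e = detachment (detachment
    (tautology (imp (imp A B) (imp (imp A C) (imp A (conj B C)))) (λ _ → refl) p q r) d) e

  ∧-→ˡ : ∀ p q → Ax ⊢ p ∧̇ q →̇ p
  ∧-→ˡ p q = tautology (imp (conj A B) A) (λ _ → refl) p q q

  ∧-→ʳ : ∀ p q → Ax ⊢ p ∧̇ q →̇ q
  ∧-→ʳ p q = tautology (imp (conj A B) B) (λ _ → refl) p q q

  →-contradiction : ∀ {p q} → Ax ⊢ p →̇ q → Ax ⊢ p →̇ ¬̇ q → Ax ⊢ ¬̇ p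
  →-contradiction {p} {q} d e = detachment (detachment
    (tautology (imp (imp A B) (imp (imp A (neg B)) (neg A))) (λ _ → refl) p q q) d) e

  ¬-by-cases : ∀ {p q} → Ax ⊢ ¬̇ (p ∧̇ q) → Ax ⊢ ¬̇ (p ∧̇ ¬̇ q) → Ax ⊢ ¬̇ p
  ¬-by-cases {p} {q} d e = detachment (detachment
    (tautology (imp (neg (conj A B)) (imp (neg (conj A (neg B))) (neg A))) (λ _ → refl) p q q) d) e

  ¬¬-elim : ∀ {p} → Ax ⊢ ¬̇ ¬̇ p → Ax ⊢ p
  ¬¬-elim {p} = detachment (tautology (imp (neg (neg A)) A) (λ _ → refl) p p p)

-- The lists are cumulative, so that the components of a compound formula can be brought to a common
-- stage.
formulas : ℕ → List Formula
formulas zero    = []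
formulas (suc n) = atom n ∷ formulas n ++ map ¬̇_ (formulas n)
                   ++ cartesianProductWith _∧̇_ (formulas n) (formulas n)
                   ++ cartesianProductWith _>̇_ (formulas n) (formulas n)

formulas-mono : ∀ {m n p} → m ≤′ n → p ∈ˡ formulas m → p ∈ˡ formulas n
formulas-mono ≤′-refl       p∈ = p∈
formulas-mono (≤′-step m≤n) p∈ = there (∈-++⁺ˡ (formulas-mono m≤n p∈))

formulas-complete : ∀ p → ∃[ n ] p ∈ˡ formulas n
formulas-complete (atom k) = suc k , here refl
formulas-complete (¬̇ p) with formulas-complete p
... | n , p∈ = suc n , there (∈-++⁺ʳ (formulas n) (∈-++⁺ˡ (∈-map⁺ ¬̇_ p∈)))
formulas-complete (p ∧̇ q) with formulas-complete p | formulas-complete q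
... | m , p∈ | n , q∈ = suc k , there (∈-++⁺ʳ (formulas k) (∈-++⁺ʳ (map ¬̇_ (formulas k)) (∈-++⁺ˡ
        (∈-cartesianProductWith⁺ _∧̇_ (formulas-mono (≤⇒≤′ (m≤m⊔n m n)) p∈)
                                     (formulas-mono (≤⇒≤′ (m≤n⊔m m n)) q∈)))))
  where k = m ⊔ n
formulas-complete (p >̇ q) with formulas-complete p | formulas-complete q
... | m , p∈ | n , q∈ = suc k , there (∈-++⁺ʳ (formulas k) (∈-++⁺ʳ (map ¬̇_ (formulas k))
        (∈-++⁺ʳ (cartesianProductWith _∧̇_ (formulas k) (formulas k))
        (∈-cartesianProductWith⁺ _>̇_ (formulas-mono (≤⇒≤′ (m≤m⊔n m n)) p∈)
                                     (formulas-mono (≤⇒≤′ (m≤n⊔m m n)) q∈)))))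
  where k = m ⊔ n

-- A maximal consistent set.  Without eta, the world built by shift stays
-- folded, which keeps implicit arguments inferable.
record World : Set where
  no-eta-equality
  field
    val   : Formula → Bool
    val-¬ : ∀ p → val (¬̇ p) ≡ not (val p)
    val-∧ : ∀ p q → val (p ∧̇ q) ≡ val p ∧ᵇ val q
    val-⊢ : ∀ {p} → C2FM ⊢ p → val p ≡ true

open World public

infix 3.5 _⊨_
record _⊨_ (Γ : World) (p : Formula) : Set where
  constructor holds
  field
    truth : val Γ p ≡ true

open _⊨_ public

module Lindenbaum (em : ∀ {a} → ExcludedMiddle a) where

  open Derivations {C2FM}

  Consistent : Formula → Set
  Consistent c = ¬ (C2FM ⊢ ¬̇ c)

  decide : Formula → Formula → Formula
  decide c q with em {P = Consistent (c ∧̇ q)}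
  ... | yes _ = c ∧̇ q
  ... | no  _ = c ∧̇ ¬̇ q

  decide-→ : ∀ c q → C2FM ⊢ decide c q →̇ c
  decide-→ c q with em {P = Consistent (c ∧̇ q)}
  ... | yes _ = ∧-→ˡ c q
  ... | no  _ = ∧-→ˡ c (¬̇ q)

  decide-decides : ∀ c q → (C2FM ⊢ decide c q →̇ q) ⊎ (C2FM ⊢ decide c q →̇ ¬̇ q)
  decide-decides c q with em {P = Consistent (c ∧̇ q)}
  ... | yes _ = inj₁ (∧-→ʳ c q)
  ... | no  _ = inj₂ (∧-→ʳ c (¬̇ q))

  -- If c were inconsistent with q and with its negation, it would be refuted by cases.
  decide-consistent : ∀ {c} q → Consistent c → Consistent (decide c q)
  decide-consistent {c} q con with em {P = Consistent (c ∧̇ q)}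
  ... | yes con′ = con′
  ... | no ¬con  = λ d → ¬con λ e → con (¬-by-cases e d)

  extend : Formula → List Formula → Formula
  extend c []       = c
  extend c (q ∷ qs) = extend (decide c q) qs

  extend-→ : ∀ c qs → C2FM ⊢ extend c qs →̇ c
  extend-→ c []       = →-refl c
  extend-→ c (q ∷ qs) = →-trans (extend-→ (decide c q) qs) (decide-→ c q)

  extend-decides : ∀ c {q qs} → q ∈ˡ qs → (C2FM ⊢ extend c qs →̇ q) ⊎ (C2FM ⊢ extend c qs →̇ ¬̇ q)
  extend-decides c {q} {_ ∷ qs} (here refl) with decide-decides c q
  ... | inj₁ d = inj₁ (→-trans (extend-→ _ qs) d)
  ... | inj₂ d = inj₂ (→-trans (extend-→ _ qs) d)
  extend-decides c {qs = r ∷ _} (there q∈) = extend-decides (decide c r) q∈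

  extend-consistent : ∀ {c} qs → Consistent c → Consistent (extend c qs)
  extend-consistent []       con = con
  extend-consistent (q ∷ qs) con = extend-consistent qs (decide-consistent q con)

  module _ {c : Formula} (con : Consistent c) where

    stage : ℕ → Formula
    stage zero    = c
    stage (suc n) = extend (stage n) (formulas n)

    stage-consistent : ∀ n → Consistent (stage n)
    stage-consistent zero    = con
    stage-consistent (suc n) = extend-consistent (formulas n) (stage-consistent n)

    stage-→ : ∀ {m n} → m ≤′ n → C2FM ⊢ stage n →̇ stage m
    stage-→ {m} ≤′-refl           = →-refl (stage m)
    stage-→ (≤′-step {n = n} m≤n) = →-trans (extend-→ (stage n) (formulas n)) (stage-→ m≤n)

    -- The deductive closure of the chain of stages; each stage is one formula standing for the
    -- finitely many decisions made so far.
    Member : Formula → Set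
    Member q = ∃[ n ] (C2FM ⊢ stage n →̇ q)

    common-stage : ∀ {p q} → Member p → Member q → ∃[ n ] (C2FM ⊢ stage n →̇ p) × (C2FM ⊢ stage n →̇ q)
    common-stage (m , d) (n , e) = m ⊔ n , →-trans (stage-→ (≤⇒≤′ (m≤m⊔n m n))) d
                                         , →-trans (stage-→ (≤⇒≤′ (m≤n⊔m m n))) e

    member-consistent : ∀ {q} → Member q → ¬ Member (¬̇ q)
    member-consistent q∈ ¬q∈ with common-stage q∈ ¬q∈
    ... | n , d , e = stage-consistent n (→-contradiction d e)

    member-complete : ∀ q → Member q ⊎ Member (¬̇ q)
    member-complete q with formulas-complete q
    ... | n , q∈ with extend-decides (stage n) q∈
    ...   | inj₁ d = inj₁ (suc n , d)
    ...   | inj₂ d = inj₂ (suc n , d)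

    lindenbaum : World
    lindenbaum = record
      { val   = λ q → does (em {P = Member q})
      ; val-¬ = λ q → case-¬ q
      ; val-∧ = case-∧
      ; val-⊢ = λ d → dec-true em (0 , →-weaken c d)
      }
      where
      case-¬ : ∀ q → does (em {P = Member (¬̇ q)}) ≡ not (does (em {P = Member q}))
      case-¬ q with em {P = Member q}
      ... | yes q∈ = dec-false em (member-consistent q∈)
      ... | no  q∉ = dec-true em ([ (λ q∈ → contradiction q∈ q∉) , (λ ¬q∈ → ¬q∈) ]′ (member-complete q))

      case-∧ : ∀ p q → does (em {P = Member (p ∧̇ q)}) ≡ does (em {P = Member p}) ∧ᵇ does (em {P = Member q})
      case-∧ p q with em {P = Member p} | em {P = Member q}
      ... | yes p∈ | yes q∈ = let n , d , e = common-stage p∈ q∈ in dec-true em (n , →-∧ d e)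
      ... | no p∉  | _      = dec-false em λ (n , d) → p∉ (n , →-trans d (∧-→ˡ p q))
      ... | yes _  | no q∉  = dec-false em λ (n , d) → q∉ (n , →-trans d (∧-→ʳ p q))

    lindenbaum-⊨ : lindenbaum ⊨ c
    lindenbaum-⊨ = holds (dec-true em (0 , →-refl c))

  refuting-world : ∀ {p} → ¬ (C2FM ⊢ p) → ∃[ Γ ] Γ ⊨ ¬̇ p
  refuting-world ⊬p = lindenbaum con , lindenbaum-⊨ con
    where con = λ d → ⊬p (¬¬-elim d)

  -- Through this, the premiss of normality can be established by reasoning inside an arbitrary
  -- world.
  ⊢-complete : ∀ {p} → (∀ Γ → Γ ⊨ p) → C2FM ⊢ p
  ⊢-complete {p} all with em {P = C2FM ⊢ p}
  ... | yes d = d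
  ... | no ⊬p with refuting-world ⊬p
  ...   | Γ , Γ⊨¬p with () ← trans (sym (truth Γ⊨¬p)) (trans (val-¬ Γ p) (cong not (truth (all Γ))))

-- Conditional logic inside a world

open Equivalence using (to; from)

infix 2 _⇛_
_⇛_ : Formula → Formula → Set
p ⇛ q = ∀ {Γ} → Γ ⊨ p → Γ ⊨ q

-- □ ¬ a without the double negation in the antecedent of □.
never : Formula → Formula
never a = a >̇ ¬̇ a

module _ {Γ : World} where

  ⊨-⊢ : ∀ {p} → C2FM ⊢ p → Γ ⊨ p
  ⊨-⊢ d = holds (val-⊢ Γ d)

  ⊨¬-elim : ∀ {p} → Γ ⊨ ¬̇ p → ¬ Γ ⊨ p
  ⊨¬-elim {p} (holds ¬p) (holds hp) with () ← trans (sym ¬p) (trans (val-¬ Γ p) (cong not hp))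

  ⊨¬-intro : ∀ {p} → ¬ Γ ⊨ p → Γ ⊨ ¬̇ p
  ⊨¬-intro {p} ¬p = holds (trans (val-¬ Γ p) (cong not (¬-not (λ h → ¬p (holds h)))))

  ⊨-dec : ∀ p → Γ ⊨ p ⊎ Γ ⊨ ¬̇ p
  ⊨-dec p with val Γ p in eq
  ... | true  = inj₁ (holds eq)
  ... | false = inj₂ (holds (trans (val-¬ Γ p) (cong not eq)))

  ⊨-by-contradiction : ∀ {p} → ¬ Γ ⊨ ¬̇ p → Γ ⊨ p
  ⊨-by-contradiction {p} ¬¬p = [ id , (λ ¬p → contradiction ¬p ¬¬p) ]′ (⊨-dec p)

  ⊨∧-elim : ∀ {p q} → Γ ⊨ p ∧̇ q → Γ ⊨ p × Γ ⊨ q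
  ⊨∧-elim {p} {q} (holds pq) with val Γ p in eq | val Γ q in eq′ | trans (sym (val-∧ Γ p q)) pq
  ... | true | true | _ = holds eq , holds eq′

  ⊨∧-elimˡ : ∀ {p q} → Γ ⊨ p ∧̇ q → Γ ⊨ p
  ⊨∧-elimˡ pq = proj₁ (⊨∧-elim pq)

  ⊨∧-elimʳ : ∀ {p q} → Γ ⊨ p ∧̇ q → Γ ⊨ q
  ⊨∧-elimʳ pq = proj₂ (⊨∧-elim pq)

  ⊨∧-intro : ∀ {p q} → Γ ⊨ p → Γ ⊨ q → Γ ⊨ p ∧̇ q
  ⊨∧-intro {p} {q} (holds hp) (holds hq) = holds (trans (val-∧ Γ p q) (cong₂ _∧ᵇ_ hp hq))

  ⊨∨-elim : ∀ {p q} → Γ ⊨ p ∨̇ q → Γ ⊨ p ⊎ Γ ⊨ q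
  ⊨∨-elim {p} {q} pq with ⊨-dec p | ⊨-dec q
  ... | inj₁ hp | _       = inj₁ hp
  ... | inj₂ _  | inj₁ hq = inj₂ hq
  ... | inj₂ ¬p | inj₂ ¬q = contradiction (⊨∧-intro ¬p ¬q) (⊨¬-elim pq)

  ⊨∨-introˡ : ∀ {p q} → Γ ⊨ p → Γ ⊨ p ∨̇ q
  ⊨∨-introˡ hp = ⊨¬-intro λ h → ⊨¬-elim (⊨∧-elimˡ h) hp

  ⊨∨-introʳ : ∀ {p q} → Γ ⊨ q → Γ ⊨ p ∨̇ q
  ⊨∨-introʳ hq = ⊨¬-intro λ h → ⊨¬-elim (⊨∧-elimʳ h) hq

  ⊨→-intro : ∀ {p q} → (Γ ⊨ p → Γ ⊨ q) → Γ ⊨ p →̇ q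
  ⊨→-intro f = ⊨¬-intro λ h → ⊨¬-elim (⊨∧-elimʳ h) (f (⊨∧-elimˡ h))

  ⊨→-elim : ∀ {p q} → Γ ⊨ p →̇ q → Γ ⊨ p → Γ ⊨ q
  ⊨→-elim h hp = ⊨-by-contradiction λ ¬q → ⊨¬-elim h (⊨∧-intro hp ¬q)

  >-refl : ∀ s → Γ ⊨ s >̇ s
  >-refl s = ⊨-⊢ (identity s)

  >-recip : ∀ {p q} → Γ ⊨ p >̇ q → Γ ⊨ q >̇ p → ∀ r → Γ ⊨ p >̇ r ⇔ Γ ⊨ q >̇ r
  >-recip {p} {q} p>q q>p r = mk⇔
    (λ p>r → ⊨→-elim (⊨-⊢ (reciprocity p q r)) (⊨∧-intro p>q (⊨∧-intro q>p p>r)))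
    (λ q>r → ⊨→-elim (⊨-⊢ (reciprocity q p r)) (⊨∧-intro q>p (⊨∧-intro p>q q>r)))

  >-MP : ∀ {p q} → Γ ⊨ p >̇ q → Γ ⊨ p → Γ ⊨ q
  >-MP {p} {q} p>q = ⊨→-elim (⊨→-elim (⊨-⊢ (MP p q)) p>q)

  >-CEM : ∀ p q → Γ ⊨ p >̇ q ⊎ Γ ⊨ p >̇ ¬̇ q
  >-CEM p q = ⊨∨-elim (⊨-⊢ (CEM p q))

  -- One direction is the axiom MP. For the other, CEM leaves only `p >̇ ¬̇ r`, which MP turns
  -- against r.
  >-centering : ∀ {p} → Γ ⊨ p → ∀ r → Γ ⊨ p >̇ r ⇔ Γ ⊨ r
  >-centering {p} hp r = mk⇔ (λ p>r → >-MP p>r hp) λ hr →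
    [ id , (λ p>¬r → contradiction hr (⊨¬-elim (>-MP p>¬r hp))) ]′ (>-CEM p r)

  ¬never : ∀ {p} → Γ ⊨ p → ¬ Γ ⊨ never p
  ¬never hp n = ⊨¬-elim (>-MP n hp) hp

¬¬-intro : ∀ {p} → p ⇛ ¬̇ ¬̇ p
¬¬-intro hp = ⊨¬-intro λ ¬p → ⊨¬-elim ¬p hp

¬¬-elim : ∀ {p} → ¬̇ ¬̇ p ⇛ p
¬¬-elim ¬¬p = ⊨-by-contradiction (⊨¬-elim ¬¬p)

verum : Formula
verum = ¬̇ (atom 0 ∧̇ ¬̇ atom 0)

⊨-verum : ∀ {Γ} → Γ ⊨ verum
⊨-verum = ⊨¬-intro λ h → ⊨¬-elim (⊨∧-elimʳ h) (⊨∧-elimˡ h)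

-- Impossible or necessary: `never (¬̇ q)` is `□ q` up to a double negation.
settled : Formula → Formula
settled q = never q ∨̇ never (¬̇ q)

allSettled : List Formula → Formula
allSettled []       = verum
allSettled (q ∷ qs) = settled q ∧̇ allSettled qs

module WorldCalculus (em : ∀ {a} → ExcludedMiddle a) where

  open Lindenbaum em

  ⇛-⊢ : ∀ {p q} → p ⇛ q → C2FM ⊢ p →̇ q
  ⇛-⊢ p⇛q = ⊢-complete λ Γ → ⊨→-intro p⇛q

  module _ {Γ : World} where

    >-∧-mono : ∀ {s p q r} → p ∧̇ q ⇛ r → Γ ⊨ s >̇ p → Γ ⊨ s >̇ q → Γ ⊨ s >̇ r
    >-∧-mono {s} h s>p s>q = ⊨→-elim (⊨-⊢ (normality s (⇛-⊢ h))) (⊨∧-intro s>p s>q)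

    >-mono : ∀ {s p q} → p ⇛ q → Γ ⊨ s >̇ p → Γ ⊨ s >̇ q
    >-mono {p = p} h s>p = >-∧-mono {q = p} (λ h′ → h (⊨∧-elimˡ h′)) s>p s>p

    >-⇛ : ∀ {s q} → s ⇛ q → Γ ⊨ s >̇ q
    >-⇛ h = >-mono h (>-refl _)

    >-cong-⇛ : ∀ {p q} → p ⇛ q → q ⇛ p → ∀ r → Γ ⊨ p >̇ r ⇔ Γ ⊨ q >̇ r
    >-cong-⇛ p⇛q q⇛p = >-recip (>-⇛ p⇛q) (>-⇛ q⇛p)

    never-> : ∀ {s} → Γ ⊨ never s → ∀ r → Γ ⊨ s >̇ r
    never-> n r = >-∧-mono (λ h → contradiction (⊨∧-elimˡ h) (⊨¬-elim (⊨∧-elimʳ h))) (>-refl _) n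

  -- Flattening freed of its syntactic form: as a entails b, `b ∧̇ a` may be exchanged for a, also
  -- within the consequent of b.
  >-flatten : ∀ {Γ a b} → a ⇛ b → ∀ r → Γ ⊨ b >̇ (a >̇ r) ⇔ Γ ⊨ a >̇ r
  >-flatten {Γ} {a} {b} a⇛b r =
    ba≡a ⇔-∘ (mk⇔ (⊨→-elim (⊨∧-elimˡ flat)) (⊨→-elim (⊨∧-elimʳ flat))
         ⇔-∘ mk⇔ (>-mono (from ba≡a)) (>-mono (to ba≡a)))
    where
    ba≡a : ∀ {Δ} → Δ ⊨ (b ∧̇ a) >̇ r ⇔ Δ ⊨ a >̇ r
    ba≡a = >-cong-⇛ ⊨∧-elimʳ (λ h → ⊨∧-intro (a⇛b h) h) r

    flat = ⊨-⊢ {Γ} (axiom (inj₁ (flattening b a r)))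

  module _ {Γ : World} where

    -- An impossible b yields `b >̇ (a >̇ ¬̇ a)` vacuously, and this flattens.
    never-mono : ∀ {a b} → a ⇛ b → Γ ⊨ never b → Γ ⊨ never a
    never-mono a⇛b n = to (>-flatten a⇛b _) (never-> n _)

    -- Since `a ∧̇ q` is never true, unflattening makes it never true at the nearest a-world either;
    -- a holds there, so q fails.
    never-⇒-> : ∀ {q} a → Γ ⊨ never q → Γ ⊨ a >̇ ¬̇ q
    never-⇒-> {q} a n = >-∧-mono {p = never (a ∧̇ q)} {q = a}
      (λ h → ⊨¬-intro λ hq → ¬never (⊨∧-intro (⊨∧-elimʳ h) hq) (⊨∧-elimˡ h))
      (from (>-flatten ⊨∧-elimˡ _) (never-mono ⊨∧-elimʳ n))
      (>-refl a)

    -- By CEM, what holds at the nearest s-world makes up a world.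
    shift : ∀ s → ¬ Γ ⊨ never s → World
    shift s _        .val r = val Γ (s >̇ r)
    shift s _        .val-⊢ d = truth (>-mono {s = s} (λ _ → ⊨-⊢ d) (>-refl {Γ} s))
    shift s possible .val-¬ p with val Γ (s >̇ p) in eq
    ... | true  = ¬-not λ h → possible (>-∧-mono
                    (λ h → contradiction (⊨∧-elimˡ h) (⊨¬-elim (⊨∧-elimʳ h)))
                    (holds {Γ} {s >̇ p} eq) (holds {Γ} {s >̇ ¬̇ p} h))
    ... | false = [ (λ h → contradiction (trans (sym eq) (truth h)) (λ ())) , truth ]′ (>-CEM {Γ} s p)
    shift s possible .val-∧ p q with val Γ (s >̇ (p ∧̇ q)) in eq
    ... | true = sym (cong₂ _∧ᵇ_ (truth (>-mono ⊨∧-elimˡ (holds {Γ} {s >̇ (p ∧̇ q)} eq)))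
                                 (truth (>-mono ⊨∧-elimʳ (holds {Γ} {s >̇ (p ∧̇ q)} eq))))
    ... | false with val Γ (s >̇ p) in eq₁ | val Γ (s >̇ q) in eq₂
    ...   | true  | true  = trans (sym eq) (truth (>-∧-mono id (holds {Γ} {s >̇ p} eq₁) (holds {Γ} {s >̇ q} eq₂)))
    ...   | true  | false = refl
    ...   | false | _     = refl

    shift-⊨ : ∀ {s possible r} → shift s possible ⊨ r ⇔ Γ ⊨ s >̇ r
    shift-⊨ = mk⇔ (λ h → holds (truth h)) (λ h → holds (truth h))

  -- Accessibility without mention of the antecedent that leads from Γ to Δ, so that steps compose
  -- as functions.
  Reaches : World → World → Set
  Reaches Γ Δ = ∀ {a} → Γ ⊨ never a → Δ ⊨ never a

  -- Unflattening gives `(s ∨̇ a) >̇ never a`. Because a is impossible, `s ∨̇ a` selects the same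
  -- world as s.
  shift-reaches : ∀ {Γ s} possible → Reaches Γ (shift {Γ} s possible)
  shift-reaches {s = s} possible {a} n = from shift-⊨
    (to (>-recip {p = s ∨̇ a} or>s (>-⇛ ⊨∨-introˡ) _) (from (>-flatten ⊨∨-introʳ _) n))
    where
    or>s = >-∧-mono {p = s ∨̇ a} {q = ¬̇ a}
      (λ h → [ id , (λ ha → contradiction ha (⊨¬-elim (⊨∧-elimʳ h))) ]′ (⊨∨-elim (⊨∧-elimˡ h)))
      (>-refl _) (never-⇒-> _ n)

  -- If `□ ◇ q` holds, McKinsey makes `□ q` possible, and q is necessary at the nearest such world.
  -- Otherwise `¬̇ ◇ q` is possible, and q is impossible at the nearest such world.
  reach-settled : ∀ Γ q → ∃[ Δ ] Reaches Γ Δ × Δ ⊨ settled q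
  reach-settled Γ q with ⊨-dec {Γ} (□ ◇ q)
  ... | inj₁ □◇q = shift (□ q) possible , shift-reaches possible ,
                   ⊨∨-introʳ (from shift-⊨ (>-mono (>-mono ¬¬-intro) (>-refl (□ q))))
    where
    possible : ¬ Γ ⊨ never (□ q)
    possible n = ⊨¬-elim (⊨→-elim (⊨-⊢ (axiom (inj₂ (mcKinsey q)))) □◇q)
      (from (>-cong-⇛ ¬¬-elim ¬¬-intro _) n)
  ... | inj₂ ¬□◇q = shift (¬̇ ◇ q) possible , shift-reaches possible ,
                    ⊨∨-introˡ (from shift-⊨ (>-mono
                      (λ h → from (>-cong-⇛ ¬¬-intro ¬¬-elim _) (¬¬-elim h)) (>-refl (¬̇ ◇ q))))
    where
    possible : ¬ Γ ⊨ never (¬̇ ◇ q)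
    possible n = ⊨¬-elim ¬□◇q (>-mono ¬¬-elim n)

  -- The formulas are settled one at a time. Both disjuncts of `settled` have the form that
  -- `Reaches` preserves, so earlier ones stay settled.
  reach-allSettled : ∀ Γ qs → ∃[ Δ ] Reaches Γ Δ × Δ ⊨ allSettled qs
  reach-allSettled Γ []       = Γ , id , ⊨-verum
  reach-allSettled Γ (q ∷ qs) with reach-settled Γ q
  ... | Δ , Γ→Δ , Δ⊨ with reach-allSettled Δ qs
  ...   | Θ , Δ→Θ , Θ⊨ = Θ , (λ n → Δ→Θ (Γ→Δ n)) , ⊨∧-intro
          ([ (λ n → ⊨∨-introˡ (Δ→Θ n)) , (λ n → ⊨∨-introʳ (Δ→Θ n)) ]′ (⊨∨-elim Δ⊨)) Θ⊨

  allSettled-possible : ∀ Γ qs → ¬ Γ ⊨ never (allSettled qs)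
  allSettled-possible Γ qs n with reach-allSettled Γ qs
  ... | Δ , Γ→Δ , Δ⊨ = ¬never Δ⊨ (Γ→Δ n)

-- Transfinite words of worlds

private
  variable
    m n : ℕ
    D : Fin n → Formula
    Γ Δ Θ : World

out : (Fin n → Formula) → Formula
out {zero}  D = verum
out {suc _} D = ¬̇ D zero ∧̇ out (D ∘ suc)

⊨out-intro : (D : Fin n → Formula) → (∀ j → ¬ Γ ⊨ D j) → Γ ⊨ out D
⊨out-intro {zero}  D _    = ⊨-verum
⊨out-intro {suc _} D none = ⊨∧-intro (⊨¬-intro (none zero)) (⊨out-intro (D ∘ suc) (none ∘ suc))

⊨out-elim : Γ ⊨ out D → ∀ j → ¬ Γ ⊨ D j
⊨out-elim h zero    = ⊨¬-elim (⊨∧-elimˡ h)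
⊨out-elim {D = D} h (suc j) = ⊨out-elim {D = D ∘ suc} (⊨∧-elimʳ h) j

out-dec : ∀ Γ (D : Fin n → Formula) → Γ ⊨ out D ⊎ ∃[ j ] Γ ⊨ D j
out-dec {zero}  Γ D = inj₁ (⊨out-intro D λ ())
out-dec {suc _} Γ D with ⊨-dec {Γ} (D zero) | out-dec Γ (D ∘ suc)
... | inj₁ h  | _            = inj₂ (zero , h)
... | inj₂ _  | inj₂ (j , h) = inj₂ (suc j , h)
... | inj₂ ¬h | inj₁ h       = inj₁ (⊨∧-intro ¬h h)

Decides : Formula → (Fin n → Formula) → Set
Decides p D = ∀ j {Γ Δ} → Γ ⊨ D j → Δ ⊨ D j → Γ ⊨ p → Δ ⊨ p

∨-out⇛out : ∀ {p} → (∀ j {Γ} → Γ ⊨ D j → ¬ Γ ⊨ p) → p ∨̇ out D ⇛ out D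
∨-out⇛out {D = D} none {Γ} h with out-dec Γ D
... | inj₁ outside  = outside
... | inj₂ (j , Dj) = [ (λ hp → contradiction hp (none j Dj)) , id ]′ (⊨∨-elim h)

infix 4 _≺_
_≺_ : Vec ℕ n → Vec ℕ n → Set
_≺_ = Lex-< _≡_ ℕ._<_

zeros : Vec ℕ n
zeros = replicate _ 0

zeros-least : {v : Vec ℕ n} → ¬ (v ≺ zeros)
zeros-least {zero}          (base ())
zeros-least {suc _} {_ ∷ _} (this () _)
zeros-least {suc _} {_ ∷ _} (next _ lt) = zeros-least lt

≺-tail : ∀ {i} {u v : Vec ℕ n} → i ∷ u ≺ i ∷ v → u ≺ v
≺-tail (this lt _) = contradiction lt (ℕ.<-irrefl refl)
≺-tail (next _ lt) = lt

≺-head : ∀ {i j} {u v : Vec ℕ n} → i ℕ.< j → ¬ (j ∷ v ≺ i ∷ u)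
≺-head i<j (this j<i _)  = ℕ.<-irrefl refl (ℕ.<-trans i<j j<i)
≺-head i<j (next refl _) = ℕ.<-irrefl refl i<j

≮-head : ∀ {i j} {u v : Vec ℕ n} → ¬ (j ∷ v ≺ i ∷ u) → i ℕ.≤ j
≮-head v≮u = ℕ.≮⇒≥ λ j<i → v≮u (this j<i refl)

≺-suc : ∀ {i w} {u v : Vec ℕ n} → w ≺ i ∷ u → w ≺ suc i ∷ v
≺-suc (this lt _)   = this (ℕ.m<n⇒m<1+n lt) refl
≺-suc (next refl _) = this (ℕ.n<1+n _) refl

-- A path of worlds inside the cells D, indexed by ω^m (Vec ℕ m in the
-- lexicographic order) with gaps, where run is nothing.  By hit and miss the
-- world selected by p at a position is the next p-world of the path; if there
-- is none, then no p-world is nearer than the first world outside D, which by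
-- exit is the same for all positions.
record Word (m : ℕ) {n} (D : Fin n → Formula) (Γ : World) : Set where
  field
    run : Vec ℕ m → Maybe World

  infix 4 _↦_
  _↦_ : Vec ℕ m → World → Set
  u ↦ Δ = run u ≡ just Δ

  field
    start  : ∃[ j ] Γ ⊨ D j → zeros ↦ Γ
    within : ∀ {u Δ} → u ↦ Δ → ∃[ j ] Δ ⊨ D j
    exit   : ∀ {u Δ} → u ↦ Δ → ∀ r → Δ ⊨ out D >̇ r ⇔ Γ ⊨ out D >̇ r
    hit    : ∀ {p u v Δ Θ} → Decides p D → u ↦ Δ → v ↦ Θ → ¬ (v ≺ u) → Θ ⊨ p →
             (∀ {x Λ} → ¬ (x ≺ u) → x ≺ v → x ↦ Λ → ¬ Λ ⊨ p) →
             ∀ r → Δ ⊨ p >̇ r ⇔ Θ ⊨ r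
    miss   : ∀ {p u Δ} → Decides p D → u ↦ Δ →
             (∀ {x Λ} → ¬ (x ≺ u) → x ↦ Λ → ¬ Λ ⊨ p) →
             Δ ⊨ (p ∨̇ out D) >̇ out D

-- Provides arbitrarily late turns of the j-th cell in the round-robin.
mod-hits : ∀ (j : Fin (suc n)) i → (toℕ j + i * suc n) mod suc n ≡ j
mod-hits {n} j i = toℕ-injective (trans (toℕ-fromℕ< (m%n<n (toℕ j + i * suc n) (suc n)))
  (trans ([m+kn]%n≡m%n (toℕ j) i (suc n)) (m<n⇒m%n≡m (toℕ<n j))))

module Words (em : ∀ {a} → ExcludedMiddle a) where

  open WorldCalculus em

  -- By flattening, a may be evaluated from the nearest world satisfying `p ∨̇ out D`. By `miss`
  -- that is the first world outside D, and by `exit` it is the same one as seen from Γ.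
  leave : ∀ {m} (w : Word m D Γ) → let open Word w in ∀ {p u Δ} → Decides p D → u ↦ Δ →
          (∀ {x Λ} → ¬ (x ≺ u) → x ↦ Λ → ¬ Λ ⊨ p) →
          ∀ {a} → a ⇛ p ∨̇ out D → ∀ r → Δ ⊨ a >̇ r ⇔ Γ ⊨ out D >̇ (a >̇ r)
  leave w dec u↦ none a⇛ r = Word.exit w u↦ _ ⇔-∘
    (>-recip (Word.miss w dec u↦ none) (>-⇛ ⊨∨-introʳ) _ ⇔-∘ ⇔-sym (>-flatten a⇛ r))

  empty : ∀ m → Γ ⊨ out D → Word m D Γ
  empty {D = D} m outside = record
    { run    = λ _ → nothing
    ; start  = λ (j , inside) → contradiction inside (⊨out-elim {D = D} outside j)
    ; within = λ ()
    ; exit   = λ ()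
    ; hit    = λ _ ()
    ; miss   = λ _ ()
    }

  -- Repeating Γ is harmless by centering: every formula true at Γ selects Γ itself.
  constant : ∀ m {c Γ} → Γ ⊨ c → Word m {1} (λ _ → c) Γ
  constant m {c} {Γ} Γ⊨c = record
    { run    = λ _ → just Γ
    ; start  = λ _ → refl
    ; within = λ where refl → zero , Γ⊨c
    ; exit   = λ where refl r → ⇔-id _
    ; hit    = λ where _ refl refl _ hp _ r → >-centering hp r
    ; miss   = λ {p} {u} → miss {p} {u}
    }
    where
    miss : ∀ {p u Δ} → Decides p (λ (_ : Fin 1) → c) → just Γ ≡ just Δ →
           (∀ {x : Vec ℕ m} {Λ} → ¬ (x ≺ u) → just Γ ≡ just Λ → ¬ Λ ⊨ p) →
           Δ ⊨ (p ∨̇ out {1} (λ _ → c)) >̇ out {1} (λ _ → c)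
    miss dec refl none = >-⇛ (∨-out⇛out λ j Λ⊨c Λ⊨p →
      none (Lex.<-irrefl ℕ.<-irrefl (≡⇒Pointwise-≡ refl)) refl (dec j Λ⊨c Γ⊨c Λ⊨p))

  -- A stage of the round-robin over D: a word that either starts in the j-th
  -- cell or can be left, inside D, only into that cell.
  record Phase (m : ℕ) {n} (D : Fin n → Formula) (j : Fin n) (Γ : World) : Set where
    field
      {size} : ℕ
      cells  : Fin size → Formula
      word   : Word m cells Γ
      inside : ∃[ i ] Γ ⊨ cells i
      subset : ∀ i → ∃[ k ] cells i ≡ D k
      target : Γ ⊨ D j ⊎ (∀ {Δ} i → Δ ⊨ out cells → Δ ⊨ D i → Δ ⊨ D j)

    open Word word public

    out-⇛ : out D ⇛ out cells
    out-⇛ {Δ} h = ⊨out-intro cells λ i Δ⊨ →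
      let k , eq = subset i in ⊨out-elim h k (subst (Δ ⊨_) eq Δ⊨)

    decides : ∀ {p} → Decides p D → Decides p cells
    decides dec i {Δ} {Θ} Δ⊨ Θ⊨ =
      let k , eq = subset i in dec k (subst (Δ ⊨_) eq Δ⊨) (subst (Θ ⊨_) eq Θ⊨)

    within-D : ∀ {u Δ} → u ↦ Δ → ∃[ k ] Δ ⊨ D k
    within-D {Δ = Δ} u↦Δ with within u↦Δ
    ... | i , Δ⊨ = let k , eq = subset i in k , subst (Δ ⊨_) eq Δ⊨

  -- The induction step: ω many words of type at most ω^n, the i-th aimed at the cell with number i
  -- modulo n + 1, are strung together.
  module Iterate {n} (D : Fin (suc n) → Formula)
                 (words : ∀ (E : Fin n → Formula) Δ → Word n E Δ) where

    Inside : Set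
    Inside = Σ[ Δ ∈ World ] ∃[ j ] Δ ⊨ D j

    phase : ∀ j (x : Inside) → Phase n D j (proj₁ x)
    phase j (Δ , i , Δ⊨) with ⊨-dec {Δ} (D j)
    ... | inj₁ Δ⊨Dj = record
      { cells  = λ _ → D j
      ; word   = constant n Δ⊨Dj
      ; inside = zero , Δ⊨Dj
      ; subset = λ _ → j , refl
      ; target = inj₁ Δ⊨Dj
      }
    ... | inj₂ Δ⊨¬Dj = record
      { cells  = D ∘ punchIn j
      ; word   = words _ Δ
      ; inside = punchOut j≢i , subst (λ k → Δ ⊨ D k) (sym (punchIn-punchOut j≢i)) Δ⊨
      ; subset = λ k → punchIn j k , refl
      ; target = inj₂ only-j
      }
      where
      j≢i : ¬ (j ≡ i)
      j≢i refl = ⊨¬-elim Δ⊨¬Dj Δ⊨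

      only-j : ∀ {Θ} i → Θ ⊨ out (D ∘ punchIn j) → Θ ⊨ D i → Θ ⊨ D j
      only-j {Θ} i Θ⊨out Θ⊨Di = ⊨-by-contradiction λ Θ⊨¬Dj →
        let j≢i : ¬ (j ≡ i)
            j≢i = λ where refl → ⊨¬-elim Θ⊨¬Dj Θ⊨Di
        in ⊨out-elim {D = D ∘ punchIn j} Θ⊨out (punchOut j≢i)
             (subst (λ k → Θ ⊨ D k) (sym (punchIn-punchOut j≢i)) Θ⊨Di)

    module At (i : ℕ) (x : Inside) = Phase (phase (i mod suc n) x)

    next-state : ℕ → Inside → Maybe Inside
    next-state i x with em {P = proj₁ x ⊨ never (out (At.cells i x))}
    ... | yes _ = nothing
    ... | no possible with out-dec (shift (out (At.cells i x)) possible) D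
    ...   | inj₁ _  = nothing
    ...   | inj₂ ∈D = just (shift (out (At.cells i x)) possible , ∈D)

    next-just : ∀ i {x y} → next-state i x ≡ just y →
                ∀ {r} → proj₁ y ⊨ r ⇔ proj₁ x ⊨ out (At.cells i x) >̇ r
    next-just i {x} eq with em {P = proj₁ x ⊨ never (out (At.cells i x))}
    next-just i () | yes _
    next-just i {x} eq | no possible with out-dec (shift (out (At.cells i x)) possible) D
    next-just i () | no _ | inj₁ _
    next-just i refl | no _ | inj₂ _ = shift-⊨

    -- The sequence of phases stops either because the phase cannot be left or because it is left to
    -- the outside of D; the first case makes the conditional vacuous.
    next-nothing : ∀ {i x} → next-state i x ≡ nothing → proj₁ x ⊨ out (At.cells i x) >̇ out D
    next-nothing {i} {x} eq with em {P = proj₁ x ⊨ never (out (At.cells i x))}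
    ... | yes impossible = never-> impossible (out D)
    ... | no possible with out-dec (shift (out (At.cells i x)) possible) D
    next-nothing eq | no _ | inj₁ outside = to shift-⊨ outside
    next-nothing () | no _ | inj₂ _

    module From (x₀ : Inside) where

      state : ℕ → Maybe Inside
      state zero    = just x₀
      state (suc i) = state i >>= next-state i

      state-suc : ∀ {i x} → state i ≡ just x → state (suc i) ≡ next-state i x
      state-suc {i} eq = cong (_>>= next-state i) eq

      state-pred : ∀ i {y} → state (suc i) ≡ just y → ∃[ x ] state i ≡ just x × next-state i x ≡ just y
      state-pred i eq with state i
      ... | just x = x , refl , eq

      state-down : ∀ d {i j y} → j ≡ d + i → state j ≡ just y → ∃[ x ] state i ≡ just x
      state-down zero    refl eq = _ , eq
      state-down (suc d) {i} refl eq = state-down d refl (proj₁ (proj₂ (state-pred (d + i) eq)))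

      run : Vec ℕ (suc n) → Maybe World
      run (i ∷ u) = state i >>= λ x → At.run i x u

      infix 4 _↦_
      _↦_ : Vec ℕ (suc n) → World → Set
      u ↦ Δ = run u ≡ just Δ

      run-intro : ∀ i {x u Δ} → state i ≡ just x → At.run i x u ≡ just Δ → i ∷ u ↦ Δ
      run-intro i {u = u} eq eq′ = trans (cong (_>>= λ x → At.run i x u) eq) eq′

      run-elim : ∀ i u {Δ} → i ∷ u ↦ Δ → ∃[ x ] state i ≡ just x × At.run i x u ≡ just Δ
      run-elim i u eq with state i
      ... | just x = x , refl , eq

      run-start : ∀ i {x} → state i ≡ just x → i ∷ zeros ↦ proj₁ x
      run-start i {x} eq = run-intro i eq (At.start i x (At.inside i x))

      -- Outside D is also outside the cells of each phase, so by flattening the first world outside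
      -- D stays the same when a phase is left for the next.
      exit-state : ∀ i {x} → state i ≡ just x → ∀ r → proj₁ x ⊨ out D >̇ r ⇔ proj₁ x₀ ⊨ out D >̇ r
      exit-state zero    refl r = ⇔-id _
      exit-state (suc i) eq   r with state-pred i eq
      ... | x , eq₁ , eq₂ = exit-state i eq₁ r ⇔-∘ (>-flatten (At.out-⇛ i x) r ⇔-∘ next-just i eq₂)

      Absent : Formula → Vec ℕ (suc n) → Set
      Absent p u = ∀ {x Λ} → ¬ (x ≺ u) → x ↦ Λ → ¬ Λ ⊨ p

      leave-phase : ∀ i {x u Δ p} → Decides p D → state i ≡ just x → At.run i x u ≡ just Δ →
                    (∀ {v Λ} → ¬ (v ≺ u) → i ∷ v ↦ Λ → ¬ Λ ⊨ p) →
                    ∀ {a} → a ⇛ p ∨̇ out (At.cells i x) →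
                    ∀ r → Δ ⊨ a >̇ r ⇔ proj₁ x ⊨ out (At.cells i x) >̇ (a >̇ r)
      leave-phase i {x} dec eq u↦ none = leave (At.word i x) (At.decides i x dec) u↦
        λ v≮u v↦ → none v≮u (run-intro i eq v↦)

      -- Induction on the number d of phase boundaries between the positions. If d is positive, p is
      -- absent from the rest of phase i, and the conditional passes to the start of the next phase.
      hit : ∀ d {i j p u v Δ Θ} → j ≡ d + i → Decides p D → i ∷ u ↦ Δ → j ∷ v ↦ Θ →
            ¬ (j ∷ v ≺ i ∷ u) → Θ ⊨ p →
            (∀ {x Λ} → ¬ (x ≺ i ∷ u) → x ≺ j ∷ v → x ↦ Λ → ¬ Λ ⊨ p) →
            ∀ r → Δ ⊨ p >̇ r ⇔ Θ ⊨ r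
      hit zero {i} {u = u} {v} refl dec u↦ v↦ v≮u Θ⊨p none r with run-elim i u u↦ | run-elim i v v↦
      ... | x , eq , u↦′ | y , eq′ , v↦′ with refl ← trans (sym eq) eq′ =
        At.hit i x (At.decides i x dec) u↦′ v↦′ (v≮u ∘ next refl) Θ⊨p
          (λ w≮u w≺v w↦ → none (w≮u ∘ ≺-tail) (next refl w≺v) (run-intro i eq w↦)) r
      hit (suc d) {i} {j} {u = u} {v} refl dec u↦ v↦ v≮u Θ⊨p none r
        with run-elim i u u↦ | state-down d (sym (ℕ.+-suc d i)) (proj₁ (proj₂ (run-elim j v v↦)))
      ... | x , eq , u↦′ | y , eq′ =
        hit d (sym (ℕ.+-suc d i)) dec (run-start (suc i) eq′) v↦ v≮y Θ⊨p
          (λ w≮y w≺v → none (w≮y ∘ ≺-suc) w≺v) r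
        ⇔-∘ (⇔-sym (next-just i (trans (sym (state-suc eq)) eq′))
        ⇔-∘ leave-phase i dec eq u↦′ (λ w≮u w↦ → none (w≮u ∘ ≺-tail) (this i<j refl) w↦) ⊨∨-introˡ r)
        where
        i<j : i ℕ.< suc (d + i)
        i<j = s≤s (ℕ.m≤n+m i d)

        v≮y : ∀ {v} → ¬ (suc (d + i) ∷ v ≺ suc i ∷ zeros)
        v≮y (this lt _) = ℕ.<-irrefl refl (ℕ.≤-trans lt (s≤s (ℕ.m≤n+m i d)))
        v≮y (next _ lt) = zeros-least lt

      absent-suc : ∀ {i p} {u v : Vec ℕ n} → Absent p (i ∷ u) → Absent p (suc i ∷ v)
      absent-suc none w≮ = none (w≮ ∘ ≺-suc)

      -- Since p is absent, the claim may be checked where the phase is left. That is outside D,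
      -- where centering applies, or the start of the next phase; the bound d on the remaining
      -- phases makes the recursion end.
      miss-dead : ∀ d {i k p u Δ} → k ≡ d + suc i → state k ≡ nothing → Decides p D → i ∷ u ↦ Δ →
                  Absent p (i ∷ u) → Δ ⊨ (p ∨̇ out D) >̇ out D
      miss-dead d {i} {p = p} {u} k≡ dead dec u↦ none with run-elim i u u↦
      ... | x , eq , u↦′ = from (leave-phase i dec eq u↦′ (λ w≮u → none (w≮u ∘ ≺-tail)) weaken (out D)) (rest d k≡)
        where
        weaken : p ∨̇ out D ⇛ p ∨̇ out (At.cells i x)
        weaken h = [ ⊨∨-introˡ , ⊨∨-introʳ ∘ At.out-⇛ i x ]′ (⊨∨-elim h)

        rest : ∀ d → _ ≡ d + suc i → proj₁ x ⊨ out (At.cells i x) >̇ ((p ∨̇ out D) >̇ out D)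
        rest d k≡ with next-state i x in eq′
        ... | nothing = >-mono (λ h → from (>-centering (⊨∨-introʳ h) _) h) (next-nothing eq′)
        rest zero refl | just y with () ← trans (sym dead) (trans (state-suc eq) eq′)
        rest (suc d) k≡ | just y = to (next-just i eq′)
          (miss-dead d (trans k≡ (sym (ℕ.+-suc d (suc i)))) dead dec
            (run-start (suc i) (trans (state-suc eq) eq′)) (absent-suc {u = u} none))

      -- If no phase is the last, every cell is visited again after phase i. A cell decides p, so a
      -- cell containing any p-world would bring p back onto the path.
      miss-alive : ∀ {i p u} → (∀ {k} → i ℕ.< k → ∃[ x ] state k ≡ just x) → Decides p D →
                   Absent p (i ∷ u) → ∀ j {Γ} → Γ ⊨ D j → ¬ Γ ⊨ p
      miss-alive {i} {p} alive dec none j Γ⊨D Γ⊨p = recurs (alive i<k)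
        where
        -- The quotient `suc i` puts this turn of cell j beyond phase i.
        k = toℕ j + suc i * suc n

        i<k : i ℕ.< k
        i<k = ℕ.≤-trans (ℕ.m≤m*n (suc i) (suc n)) (ℕ.m≤n+m (suc i * suc n) (toℕ j))

        visits : ∀ k {x} → i ℕ.< k → state k ≡ just x → ¬ proj₁ x ⊨ D j
        visits k i<k eq x⊨ = none (≺-head i<k) (run-start k eq) (dec j Γ⊨D x⊨ Γ⊨p)

        recurs : ¬ (∃[ x ] state k ≡ just x)
        recurs (x , eq) with subst (λ l → proj₁ x ⊨ D l ⊎ (∀ {Δ} i → Δ ⊨ out (At.cells k x) → Δ ⊨ D i → Δ ⊨ D l))
                                   (mod-hits j (suc i)) (At.target k x)
        ... | inj₁ x⊨ = visits k i<k eq x⊨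
        -- Phase k starts elsewhere but is left inside D, hence into cell j: the visit is the start
        -- of phase k + 1.
        ... | inj₂ only-j with alive (ℕ.m<n⇒m<1+n i<k)
        ...   | (y , l , y⊨) , eq′ = visits (suc k) (ℕ.m<n⇒m<1+n i<k) eq′
                (only-j l (from (next-just k (trans (sym (state-suc eq)) eq′)) (>-refl _)) y⊨)

      miss : ∀ {i p u Δ} → Decides p D → i ∷ u ↦ Δ → Absent p (i ∷ u) → Δ ⊨ (p ∨̇ out D) >̇ out D
      miss {i} dec u↦ none with em {P = ∃[ k ] i ℕ.< k × state k ≡ nothing}
      ... | yes (k , i<k , dead) with ℕ.m≤n⇒∃[o]m+o≡n i<k
      ...   | d , eq = miss-dead d (trans (sym eq) (ℕ.+-comm (suc i) d)) dead dec u↦ none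
      miss {i} dec u↦ none | no never-dead = >-⇛ (∨-out⇛out (miss-alive alive dec none))
        where
        alive : ∀ {k} → i ℕ.< k → ∃[ x ] state k ≡ just x
        alive {k} i<k with state k in eq
        ... | just x  = x , refl
        ... | nothing = contradiction (k , i<k , eq) never-dead

      iterated : Word (suc n) D (proj₁ x₀)
      iterated = record
        { run    = run
        ; start  = λ _ → run-start 0 refl
        ; within = λ {u} → run-within u
        ; exit   = λ {u} → run-exit u
        ; hit    = λ {_} {u} {v} → run-hit u v
        ; miss   = λ {_} {u} → run-miss u
        }
        where
        run-within : ∀ u {Δ} → u ↦ Δ → ∃[ j ] Δ ⊨ D j
        run-within (i ∷ u) u↦ = let x , _ , u↦′ = run-elim i u u↦ in At.within-D i x u↦′

        run-exit : ∀ u {Δ} → u ↦ Δ → ∀ r → Δ ⊨ out D >̇ r ⇔ proj₁ x₀ ⊨ out D >̇ r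
        run-exit (i ∷ u) u↦ r = let x , eq , u↦′ = run-elim i u u↦ in
          exit-state i eq r ⇔-∘ (>-flatten (At.out-⇛ i x) r ⇔-∘
            (At.exit i x u↦′ _ ⇔-∘ ⇔-sym (>-flatten (At.out-⇛ i x) r)))

        run-hit : ∀ u v {p Δ Θ} → Decides p D → u ↦ Δ → v ↦ Θ → ¬ (v ≺ u) → Θ ⊨ p →
                  (∀ {x Λ} → ¬ (x ≺ u) → x ≺ v → x ↦ Λ → ¬ Λ ⊨ p) →
                  ∀ r → Δ ⊨ p >̇ r ⇔ Θ ⊨ r
        run-hit (i ∷ _) (j ∷ _) dec u↦ v↦ v≮u =
          let d , eq = ℕ.m≤n⇒∃[o]m+o≡n (≮-head v≮u) in
          hit d (trans (sym eq) (ℕ.+-comm i d)) dec u↦ v↦ v≮u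

        run-miss : ∀ u {p Δ} → Decides p D → u ↦ Δ → Absent p u → Δ ⊨ (p ∨̇ out D) >̇ out D
        run-miss (_ ∷ _) = miss

  word : ∀ n (D : Fin n → Formula) Γ → Word n D Γ
  word n D Γ with out-dec Γ D
  word n       D Γ | inj₁ outside = empty n outside
  word (suc n) D Γ | inj₂ inside  = Iterate.From.iterated D (word n) (Γ , inside)

-- The countermodel

-- The tails of the identity sequence on α are pairwise distinct, so their tail
-- order at w is the order of α from w on.
module LinearFrame (α : Ordinal ℓ) (last : Ordinal.Carrier α)
                   (last-greatest : ∀ x → ¬ Ordinal._<_ α last x) where

  open SequenceProperties
  open Ordinal α hiding (_<⁺_)

  whole : Sequence Carrier
  whole = record { length = α ; at = id }

  open Order whole using (<ᵢ-asym; <ᵢ-trans; compare; pos-irrefl; pos-compare; _<⁺_; in-tail; tail-≮)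

  <-irrefl : ∀ {x} → ¬ (x < x)
  <-irrefl x<x = <ᵢ-asym x<x x<x

  tail : Carrier → Sequence Carrier
  tail w = whole [ [ w ] :]

  -- Entries are their own indices and isomorphisms preserve entries, so the earlier of two distinct
  -- starting points would have to occur in the later tail.
  tail-injective : ∀ {w γ} → tail w ≈ whole [ γ :] → γ ≡ [ w ]
  tail-injective {w} {γ} e with pos-compare γ [ w ]
  ... | tri≈ _ γ≡w _ = γ≡w
  ... | tri> _ _ w<γ = contradiction w<γ (subst (λ i → ¬ ([ i ] <⁺ γ)) (sym (at-≡ i)) (tail-≮ (to′ i)))
    where
    open Iso e renaming (to to to′)
    i = in-tail w λ where [ w<w ] → <-irrefl w<w
  ... | tri< [ v<w ] _ _ = contradiction [ v<w ]
          (subst (λ i → ¬ ([ i ] <⁺ [ w ])) (sym (at-≡ i)) (tail-≮ (to′ i)))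
    where
    open Iso (≈-sym e) renaming (to to to′)
    i = in-tail _ λ where [ v<v ] → <-irrefl v<v

  module Tail w = Shift {σ = whole} {tail w} {[ w ]} ≈-refl

  infix 4 _∶_≺_
  _∶_≺_ : Carrier → Rel Carrier ℓ
  _∶_≺_ = tailOrder tail

  ≺-elim : ∀ {w x y} → w ∶ x ≺ y → ¬ (x < w) × x < y
  ≺-elim {w} {x} {y} (β , γ , (x≈ , _) , (y≈ , _) , β<γ) =
      (λ x<w → Tail.shift-≮ w β (subst (_<⁺ [ w ]) (sym β≡x) [ x<w ]))
    , Supremum.[<]-injective _ (subst (_<⁺ [ y ]) β≡x (subst (Tail.shift w β <⁺_) γ≡y (Tail.shift-mono w β<γ)))
    where
    β≡x = tail-injective (≈-trans x≈ (Tail.tail-shift w β))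
    γ≡y = tail-injective (≈-trans y≈ (Tail.tail-shift w γ))

  -- A tail occurs at one position only, so its occurrence is automatically its first.
  rank : ∀ {w} x → ¬ (x < w) → ∃[ β ] Tail.shift w β ≡ [ x ] × IsRank (tail w) (tail x) β
  rank {w} x x≮w with Tail.unshift w [ x ] (λ where [ x<w ] → x≮w x<w)
  ... | β , β≡x = β , β≡x
      , ≈-sym (subst (λ γ → tail w [ β :] ≈ whole [ γ :]) β≡x (Tail.tail-shift w β))
      , λ γ γ<β x≈ → let γ≡x = tail-injective (≈-trans x≈ (Tail.tail-shift w γ)) in
          pos-irrefl (subst (Tail.shift w γ <⁺_) (trans β≡x (sym γ≡x)) (Tail.shift-mono w γ<β))

  ≺-intro : ∀ {w x y} → ¬ (x < w) → x < y → w ∶ x ≺ y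
  ≺-intro {w} {x} {y} x≮w x<y
    with rank x x≮w | rank y (λ y<w → x≮w (<ᵢ-trans x<y y<w))
  ... | β , β≡x , x-rank | γ , γ≡y , y-rank = β , γ , x-rank , y-rank ,
    Tail.shift-cancel w (subst (_<⁺ Tail.shift w γ) (sym β≡x) (subst ([ x ] <⁺_) (sym γ≡y) [ x<y ]))

  frame : OrdinalSequenceFrame ℓ
  frame = record
    { P            = Carrier
    ; P-nonempty   = last
    ; W            = Carrier
    ; seq          = tail
    ; seq-distinct = λ e → sym ([]-injective (tail-injective e))
    ; isOrderFrame = record
      { nonempty    = last
      ; domain      = λ w x → ¬ (x < w)
      ; isWellOrder = λ w → record
        { within      = λ x≺y → let x≮w , x<y = ≺-elim x≺y in x≮w , λ y<w → x≮w (<ᵢ-trans x<y y<w)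
        ; trans       = λ x≺y y≺z → let x≮w , x<y = ≺-elim x≺y in
                          ≺-intro x≮w (<ᵢ-trans x<y (proj₂ (≺-elim y≺z)))
        ; compare     = compare-≺
        ; wellFounded = Subrelation.wellFounded (proj₂ ∘ ≺-elim) wellFounded
        }
      ; below       = below
      }
    }
    where
    compare-≺ : ∀ {w x y} → ¬ (x < w) → ¬ (y < w) → Tri (w ∶ x ≺ y) (x ≡ y) (w ∶ y ≺ x)
    compare-≺ {w} {x} {y} x≮w y≮w with compare x y
    ... | tri< x<y x≢y y≮x = tri< (≺-intro x≮w x<y) x≢y (y≮x ∘ proj₂ ∘ ≺-elim)
    ... | tri≈ x≮y x≡y y≮x = tri≈ (x≮y ∘ proj₂ ∘ ≺-elim) x≡y (y≮x ∘ proj₂ ∘ ≺-elim)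
    ... | tri> x≮y x≢y y<x = tri> (x≮y ∘ proj₂ ∘ ≺-elim) x≢y (≺-intro y≮w y<x)

    below : ∀ {w x y} → w ∶ x ≺ y → w ≡ x ⊎ w ∶ w ≺ x
    below {w} {x} x≺y with compare w x
    ... | tri< w<x _ _ = inj₂ (≺-intro <-irrefl w<x)
    ... | tri≈ _ w≡x _ = inj₁ w≡x
    ... | tri> _ _ x<w = contradiction x<w (proj₁ (≺-elim x≺y))

  -- The witness is the one-term tail at `last`; the empty tail is not in the frame, as its worlds
  -- start at indices.
  isFinal : IsFinal frame
  isFinal w with rank {w} last (last-greatest w)
  ... | β , β≡last , (last≈ , _) = β , (last , last≈) , λ γ γ≮β (u , u≈) →
      ≈-trans (≈-sym u≈) (subst (λ v → tail v ≈ tail w [ β :]) (sym (is-last γ≮β u≈)) last≈)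
    where
    is-last : ∀ {γ u} → ¬ (Sequence._<⁺_ (tail w) γ β) → tail u ≈ tail w [ γ :] → u ≡ last
    is-last {γ} {u} γ≮β u≈ with compare u last
    ... | tri≈ _ u≡last _ = u≡last
    ... | tri> _ _ last<u = contradiction last<u (last-greatest u)
    ... | tri< u<last _ _ = contradiction (Tail.shift-cancel w
            (subst (_<⁺ Tail.shift w β) (sym (tail-injective (≈-trans u≈ (Tail.tail-shift w γ))))
              (subst ([ u ] <⁺_) (sym β≡last) [ u<last ])))
            γ≮β

-- State descriptions and subformulas

cells : Formula → List Formula → List Formula
cells c []       = c ∷ []
cells c (q ∷ qs) = map (q ∧̇_) (cells c qs) ++ map (¬̇ q ∧̇_) (cells c qs)

cells-cover : ∀ {c Γ} qs → Γ ⊨ c → ∃[ d ] d ∈ˡ cells c qs × Γ ⊨ d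
cells-cover []       Γ⊨c = _ , here refl , Γ⊨c
cells-cover {c} {Γ} (q ∷ qs) Γ⊨c with cells-cover qs Γ⊨c | ⊨-dec {Γ} q
... | d , d∈ , Γ⊨d | inj₁ Γ⊨q  = q ∧̇ d , ∈-++⁺ˡ (∈-map⁺ (q ∧̇_) d∈) , ⊨∧-intro Γ⊨q Γ⊨d
... | d , d∈ , Γ⊨d | inj₂ Γ⊨¬q =
  ¬̇ q ∧̇ d , ∈-++⁺ʳ (map (q ∧̇_) (cells c qs)) (∈-map⁺ (¬̇ q ∧̇_) d∈) , ⊨∧-intro Γ⊨¬q Γ⊨d

cells-⇛ : ∀ {c d} qs → d ∈ˡ cells c qs → d ⇛ c
cells-⇛ []       (here refl) Γ⊨d = Γ⊨d
cells-⇛ {c} (q ∷ qs) d∈ Γ⊨d with ∈-++⁻ (map (q ∧̇_) (cells c qs)) d∈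
... | inj₁ d∈′ with _ , e∈ , refl ← ∈-map⁻ (q ∧̇_) d∈′ = cells-⇛ qs e∈ (⊨∧-elimʳ Γ⊨d)
... | inj₂ d∈′ with _ , e∈ , refl ← ∈-map⁻ (¬̇ q ∧̇_) d∈′ = cells-⇛ qs e∈ (⊨∧-elimʳ Γ⊨d)

cells-decide : ∀ {c d q Γ Δ} qs → q ∈ˡ qs → d ∈ˡ cells c qs → Γ ⊨ d → Δ ⊨ d → Γ ⊨ q → Δ ⊨ q
cells-decide {c} (r ∷ qs) q∈ d∈ Γ⊨d Δ⊨d Γ⊨q with ∈-++⁻ (map (r ∧̇_) (cells c qs)) d∈
cells-decide (r ∷ qs) (here refl) d∈ Γ⊨d Δ⊨d Γ⊨q | inj₁ d∈′
  with _ , e∈ , refl ← ∈-map⁻ (r ∧̇_) d∈′ = ⊨∧-elimˡ Δ⊨d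
cells-decide (r ∷ qs) (here refl) d∈ Γ⊨d Δ⊨d Γ⊨q | inj₂ d∈′
  with _ , e∈ , refl ← ∈-map⁻ (¬̇ r ∧̇_) d∈′ = contradiction Γ⊨q (⊨¬-elim (⊨∧-elimˡ Γ⊨d))
cells-decide (r ∷ qs) (there q∈) d∈ Γ⊨d Δ⊨d Γ⊨q | inj₁ d∈′
  with _ , e∈ , refl ← ∈-map⁻ (r ∧̇_) d∈′ = cells-decide qs q∈ e∈ (⊨∧-elimʳ Γ⊨d) (⊨∧-elimʳ Δ⊨d) Γ⊨q
cells-decide (r ∷ qs) (there q∈) d∈ Γ⊨d Δ⊨d Γ⊨q | inj₂ d∈′
  with _ , e∈ , refl ← ∈-map⁻ (¬̇ r ∧̇_) d∈′ = cells-decide qs q∈ e∈ (⊨∧-elimʳ Γ⊨d) (⊨∧-elimʳ Δ⊨d) Γ⊨q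

subformulas : Formula → List Formula
subformulas p@(atom _)  = p ∷ []
subformulas p@(¬̇ q)     = p ∷ subformulas q
subformulas p@(q ∧̇ r)   = p ∷ subformulas q ++ subformulas r
subformulas p@(q >̇ r)   = p ∷ subformulas q ++ subformulas r

self-subformula : ∀ p → p ∈ˡ subformulas p
self-subformula (atom _) = here refl
self-subformula (¬̇ _)    = here refl
self-subformula (_ ∧̇ _)  = here refl
self-subformula (_ >̇ _)  = here refl

-- From the path of worlds to the refuting model

module Completeness (em : ∀ {a} → ExcludedMiddle a) (qs : List Formula) (Γ₀ : World) where

  open Classical em
  open WorldCalculus em
  open Words em

  -- Conjoining `¬̇ allSettled qs` to every state description makes `out cell` equivalent to
  -- `allSettled qs`.
  unsettled : List Formula
  unsettled = cells (¬̇ allSettled qs) qs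

  size : ℕ
  size = List.length unsettled

  cell : Fin size → Formula
  cell = lookup unsettled

  cell-decides : ∀ {q} → q ∈ˡ qs → Decides q cell
  cell-decides q∈ j = cells-decide qs q∈ (∈-lookup j)

  settled⇛out : allSettled qs ⇛ out cell
  settled⇛out h = ⊨out-intro cell λ j Γ⊨ → ⊨¬-elim (cells-⇛ qs (∈-lookup j) Γ⊨) h

  out⇛settled : out cell ⇛ allSettled qs
  out⇛settled {Γ} h = ⊨-by-contradiction λ ¬s →
    let d , d∈ , Γ⊨d = cells-cover qs ¬s in
    ⊨out-elim {D = cell} h (index d∈) (subst (Γ ⊨_) (lookup-index d∈) Γ⊨d)

  out-possible : ¬ Γ₀ ⊨ never (out cell)
  out-possible n = allSettled-possible Γ₀ qs (never-mono settled⇛out n)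

  final : World
  final = shift (out cell) out-possible

  final-settled : ∀ {q} → q ∈ˡ qs → final ⊨ settled q
  final-settled = pick qs (out⇛settled (from shift-⊨ (>-refl (out cell))))
    where
    pick : ∀ {q} rs → final ⊨ allSettled rs → q ∈ˡ rs → final ⊨ settled q
    pick (_ ∷ _)  h (here refl) = ⊨∧-elimˡ h
    pick (_ ∷ rs) h (there q∈)  = pick rs (⊨∧-elimʳ h) q∈

  module w = Word (word size cell Γ₀)

  world? : Vec ℕ size ⁺ → Maybe World
  world? [ u ] = w.run u
  world? ⊤⁺    = just final

  -- The gaps of the run are dropped here. Definedness is an irrelevant component, so equal values
  -- give equal positions.
  Position : Set
  Position = [ x ∈ Vec ℕ size ⁺ ∣ T (is-just (world? x)) ]

  extract : (x : Maybe World) → .(T (is-just x)) → World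
  extract (just Δ) _ = Δ

  extract-just : ∀ x .(t : T (is-just x)) → x ≡ just (extract x t)
  extract-just (just _) _ = refl

  world : Position → World
  world (x , [ t ]) = extract (world? x) t

  world-just : ∀ x → world? (value x) ≡ just (world x)
  world-just (x , [ t ]) = extract-just (world? x) t

  position : ∀ x {Δ} → world? x ≡ just Δ → Position
  position x eq = x , [ subst (T ∘ is-just) (sym eq) _ ]

  position-⊨ : ∀ x {Δ} (eq : world? x ≡ just Δ) {q} → Δ ⊨ q → world (position x eq) ⊨ q
  position-⊨ x eq = subst (_⊨ _) (just-injective (trans (sym eq) (world-just (position x eq))))

  open Supremum (_≺_ {size}) using (_<⁺_)

  infix 4 _<ₚ_
  _<ₚ_ : Rel Position _
  _<ₚ_ = _<⁺_ on value

  leave-word : ∀ {q u Δ} → q ∈ˡ qs → w.run u ≡ just Δ →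
               (∀ {v Λ} → ¬ (v ≺ u) → w.run v ≡ just Λ → ¬ Λ ⊨ q) →
               ∀ r → Δ ⊨ q >̇ r ⇔ final ⊨ q >̇ r
  leave-word q∈ u↦ none r =
    ⇔-sym shift-⊨ ⇔-∘ leave (word size cell Γ₀) (cell-decides q∈) u↦ none ⊨∨-introˡ r

  hit : ∀ {q} → q ∈ˡ qs → ∀ u v → ¬ (v <ₚ u) → world v ⊨ q →
        (∀ x → ¬ (x <ₚ u) → x <ₚ v → ¬ world x ⊨ q) →
        ∀ r → world u ⊨ q >̇ r ⇔ world v ⊨ r
  hit q∈ u@([ _ ] , _) v@([ _ ] , _) v≮u v⊨q none =
    w.hit (cell-decides q∈) (world-just u) (world-just v) (v≮u ∘ [_]) v⊨q
      λ {x} x≮u x≺v eq x⊨q → none (position [ x ] eq) (λ where [ x≺u ] → x≮u x≺u) [ x≺v ]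
        (position-⊨ [ x ] eq x⊨q)
  -- The path is left without meeting q, and centering applies at the final world.
  hit q∈ u@([ _ ] , _) (⊤⁺ , _) v≮u v⊨q none r =
    >-centering v⊨q r ⇔-∘ leave-word q∈ (world-just u)
      (λ {x} x≮u eq x⊨q → none (position [ x ] eq) (λ where [ x≺u ] → x≮u x≺u) [ x ]<⊤⁺
        (position-⊨ [ x ] eq x⊨q)) r
  hit q∈ (⊤⁺ , _) ([ v ] , _) v≮u = contradiction [ v ]<⊤⁺ v≮u
  hit q∈ (⊤⁺ , _) (⊤⁺ , _) _ v⊨q _ r = >-centering v⊨q r

  -- The final world has q settled and false, so q is impossible there and the conditional vacuous;
  -- `leave-word` carries this back along the path.
  miss : ∀ {q} → q ∈ˡ qs → ∀ u → (∀ x → ¬ (x <ₚ u) → ¬ world x ⊨ q) → ∀ r → world u ⊨ q >̇ r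
  miss {q} q∈ u none r = case u none
    where
    final-miss : ¬ final ⊨ q → final ⊨ q >̇ r
    final-miss ¬q = [ (λ n → never-> n r) , (λ n → contradiction n (¬never (⊨¬-intro ¬q))) ]′
                      (⊨∨-elim (final-settled q∈))

    case : ∀ u → (∀ x → ¬ (x <ₚ u) → ¬ world x ⊨ q) → world u ⊨ q >̇ r
    case (⊤⁺ , _)      none = final-miss (none (⊤⁺ , _) λ ())
    case u@([ _ ] , _) none = from (leave-word q∈ (world-just u)
      (λ {x} x≮u eq x⊨q → none (position [ x ] eq) (λ where [ x≺u ] → x≮u x≺u)
        (position-⊨ [ x ] eq x⊨q)) r)
      (final-miss (none (⊤⁺ , _) λ ()))

  initial : ∃[ u ] (∀ {r} → Γ₀ ⊨ r → world u ⊨ r)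
  initial with out-dec Γ₀ cell
  ... | inj₂ inside  = position [ zeros ] (w.start inside) , position-⊨ [ zeros ] (w.start inside)
  -- Here `Γ₀` is already settled, so by centering the final world agrees with it.
  ... | inj₁ outside = (⊤⁺ , _) , λ Γ₀⊨ → from shift-⊨ (from (>-centering outside _) Γ₀⊨)

  ordinal : ∀ ℓ → Ordinal ℓ
  ordinal ℓ = record
    { Carrier            = Lift ℓ Position
    ; _<_                = λ x y → Lift ℓ (lower x <ₚ lower y)
    ; isStrictTotalOrder = isStrictTotalOrderᶜ record
      { isEquivalence = isEquivalence
      ; trans         = λ x<y y<z → lift (<⁺-trans _ ≺-trans (lower x<y) (lower y<z))
      ; compare       = compare
      }
    ; wellFounded        = Subrelation.wellFounded lower
        (On.wellFounded (value ∘ lower) (<⁺-wellFounded (Lex.<-wellFounded trans (proj₁ (resp₂ ℕ._<_)) ℕ.<-wellFounded)))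
    }
    where
    ≺-trans : Transitive (_≺_ {size})
    ≺-trans = Lex.<-trans (IsEquivalence.isPartialEquivalence isEquivalence) (resp₂ _) ℕ.<-trans

    ≺-compare : Trichotomous _≡_ (_≺_ {size})
    ≺-compare u v with Lex.<-cmp sym ℕ.<-cmp u v
    ... | tri< u≺v u≢v v⊀u = tri< u≺v (u≢v ∘ ≡⇒Pointwise-≡) v⊀u
    ... | tri≈ u⊀v u≡v v⊀u = tri≈ u⊀v (Pointwise-≡⇒≡ u≡v) v⊀u
    ... | tri> u⊀v u≢v v≺u = tri> u⊀v (u≢v ∘ ≡⇒Pointwise-≡) v≺u

    compare : Trichotomous _≡_ (λ x y → Lift ℓ (lower x <ₚ lower y))
    compare (lift x) (lift y) with <⁺-cmp-≡ _ ≺-compare (value x) (value y)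
    ... | tri< x<y x≢y y≮x = tri< (lift x<y) (x≢y ∘ cong (value ∘ lower)) (y≮x ∘ lower)
    ... | tri≈ x≮y x≡y y≮x = tri≈ (x≮y ∘ lower) (cong lift (value-injective x≡y)) (y≮x ∘ lower)
    ... | tri> x≮y x≢y y<x = tri> (x≮y ∘ lower) (x≢y ∘ cong (value ∘ lower)) (lift y<x)

  module Countermodel (ℓ : Level) where

    open LinearFrame (ordinal ℓ) (lift (⊤⁺ , _)) (λ _ ()) public
      using (frame; isFinal; ≺-intro; ≺-elim; <-irrefl)
    open IsStrictTotalOrder (Ordinal.isStrictTotalOrder (ordinal ℓ)) using (compare)

    V : ℕ → Lift ℓ Position → Bool
    V k x = val (world (lower x)) (atom k)

    model : OrderModel ℓ
    model = ⟨ OrdinalSequenceFrame.orderFrame frame , V ⟩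

    open OrderModel model using (R; ⟦_⟧)
    open Soundness model using (Nearest; >-intro)

    R-intro : ∀ {w x} → ¬ (x <ₚ w) → lift x ∈ R (lift w)
    R-intro {w} {x} x≮w with compare (lift w) (lift x)
    ... | tri< w<x _ _ = inj₂ (≺-intro {lift w} (<-irrefl {lift w}) w<x)
    ... | tri≈ _ w≡x _ = inj₁ w≡x
    ... | tri> _ _ x<w = contradiction (lower x<w) x≮w

    R-elim : ∀ {w x} → x ∈ R w → ¬ (lower x <ₚ lower w)
    R-elim {w} (inj₁ refl) w<w = <-irrefl {w} (lift w<w)
    R-elim {w} {x} (inj₂ w≺x) x<w with compare w x
    ... | tri< _ _ x≮w = x≮w (lift x<w)
    ... | tri≈ _ _ x≮w = x≮w (lift x<w)
    ... | tri> w≮x _ _ = w≮x (proj₂ (≺-elim w≺x))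

    -- For a conditional, `hit` treats the nearest p-world and `miss` the case that there is none;
    -- both require the antecedent to be in `qs`.
    truth-lemma : ∀ p → (∀ {q} → q ∈ˡ subformulas p → q ∈ˡ qs) → ∀ w → ⟦ p ⟧ w ⇔ world (lower w) ⊨ p
    truth-lemma (atom k) sub w = mk⇔ (λ h → holds (lower h)) (λ h → lift (truth h))
    truth-lemma (¬̇ p) sub w =
      mk⇔ (λ h → ⊨¬-intro (h ∘ from ih)) (λ h → ⊨¬-elim h ∘ to ih)
      where ih = truth-lemma p (sub ∘ there) w
    truth-lemma (p ∧̇ q) sub w = mk⇔ (λ (hp , hq) → ⊨∧-intro (to ihp hp) (to ihq hq))
                                    (λ h → from ihp (⊨∧-elimˡ h) , from ihq (⊨∧-elimʳ h))
      where
      ihp = truth-lemma p (sub ∘ there ∘ ∈-++⁺ˡ) w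
      ihq = truth-lemma q (sub ∘ there ∘ ∈-++⁺ʳ (subformulas p)) w
    truth-lemma (p >̇ q) sub w@(lift u) = mk⇔ forth back
      where
      ihp = truth-lemma p (sub ∘ there ∘ ∈-++⁺ˡ)
      ihq = truth-lemma q (sub ∘ there ∘ ∈-++⁺ʳ (subformulas p))

      p∈qs : p ∈ˡ qs
      p∈qs = sub (there (∈-++⁺ˡ (self-subformula p)))

      hit-nearest : ∀ {y} → Nearest w ⟦ p ⟧ y → world u ⊨ p >̇ q ⇔ world (lower y) ⊨ q
      hit-nearest {y} (y∈R , py , first) = hit p∈qs u (lower y) (R-elim y∈R) (to (ihp y) py)
        (λ x x≮u x<y x⊨p → first (lift x) (≺-intro (x≮u ∘ lower) (lift x<y)) (from (ihp (lift x)) x⊨p)) q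

      forth : ⟦ p >̇ q ⟧ w → world u ⊨ p >̇ q
      forth (inj₁ none) = miss p∈qs u (λ x x≮u x⊨p → none (lift x) (R-intro x≮u , from (ihp (lift x)) x⊨p)) q
      forth (inj₂ (y , (y∈R , py , qy) , first)) = from (hit-nearest (y∈R , py , first)) (to (ihq y) qy)

      back : world u ⊨ p >̇ q → ⟦ p >̇ q ⟧ w
      back u⊨ = >-intro {p} {q} λ {y} near → from (ihq y) (to (hit-nearest near) u⊨)

theorem6p5 : (∀ {a} → ExcludedMiddle a) →
    ∀ ℓ (p : Formula) →
    (C2FM ⊢ p) ⇔
    (∀ (F : OrdinalSequenceFrame ℓ) → IsFinal F →
    ∀ V w → TrueAt ⟨ OrdinalSequenceFrame.orderFrame F , V ⟩ w p)
theorem6p5 em ℓ p = mk⇔ (λ d F final V → ClassicalFrames.C2FM-sound em F final V d) complete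
  where
  open Lindenbaum em

  complete : (∀ (F : OrdinalSequenceFrame ℓ) → IsFinal F →
              ∀ V w → TrueAt ⟨ OrdinalSequenceFrame.orderFrame F , V ⟩ w p) → C2FM ⊢ p
  complete valid = Classical.by-contradiction em λ ⊬p →
    let Γ , Γ⊨¬p = refuting-world ⊬p
        open Completeness em (subformulas p) Γ
        open Countermodel ℓ
        u , Γ⇒u = initial
    in ⊨¬-elim (Γ⇒u Γ⊨¬p) (to (truth-lemma p id (lift u)) (valid frame isFinal V (lift u)))
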